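{- For every constant $K>0$ there exist constants $c,C>0$ (depending only on $K$) such that for all integers $r\ge 2$ and $n$ with $2r-1\le n\le K r^2$, \[ 2^{c\, r^2/n}\;\le\; f(n,r)\;\le\; 2^{C\,(r^2/n)\log_2(n/r)} \;=\; (n/r)^{C r^2/n}. \] That is, $f(n,r)=2^{\tilde{\Theta}(r^2/n)}$ for $3\le 2r-1\le n\le O(r^2)$, where $\tilde\Theta$ hides a factor logarithmic in $n/r$ in the exponent.
   Context: A hypergraph is $r$-uniform if every edge has exactly $r$ vertices. A hypergraph is intersecting if any two edges have non-empty intersection. The cover number $\tau(H)$ of a hypergraph $H$ is the minimum size of a set of vertices meeting every edge. For integers $n\ge 2r-1\ge 3$, $f(n,r)$ denotes the minimum number of edges in an $n$-vertex $r$-uniform intersecting hypergraph with cover number equal to $r$. -}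

module Defs where

open import Data.Nat using (ℕ; _≤_)
open import Data.Product using (Σ; ∃; _×_)
open import Data.List using (List; length)
open import Data.List.Membership.Propositional using () renaming (_∈_ to _∈ₗ_)
open import Data.List.Relation.Unary.Unique.Propositional using (Unique)
open import Data.Fin.Subset using (Subset; _∩_; ∣_∣; Nonempty)
open import Relation.Binary.PropositionalEquality using (_≡_)

record Hypergraph (n : ℕ) : Set where
  field
    edges  : List (Subset n)
    unique : Unique edges
open Hypergraph public

numEdges : ∀ {n} → Hypergraph n → ℕ
numEdges H = length (edges H)

Uniform : ∀ {n} → ℕ → Hypergraph n → Set
Uniform r H = ∀ e → e ∈ₗ edges H → ∣ e ∣ ≡ r

Intersecting : ∀ {n} → Hypergraph n → Set
Intersecting H = ∀ e₁ e₂ → e₁ ∈ₗ edges H → e₂ ∈ₗ edges H → Nonempty (e₁ ∩ e₂)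

IsCover : ∀ {n} → Hypergraph n → Subset n → Set
IsCover H T = ∀ e → e ∈ₗ edges H → Nonempty (e ∩ T)

CoverNumber : ∀ {n} → Hypergraph n → ℕ → Set
CoverNumber {n} H t =
  (Σ (Subset n) λ T → IsCover H T × ∣ T ∣ ≡ t) ×
  (∀ (T : Subset n) → IsCover H T → t ≤ ∣ T ∣)

Admissible : (n r : ℕ) → Hypergraph n → Set
Admissible n r H = Uniform r H × Intersecting H × CoverNumber H r

IsF : (n r m : ℕ) → Set
IsF n r m =
  (Σ (Hypergraph n) λ H → Admissible n r H × numEdges H ≡ m) ×
  (∀ (H : Hypergraph n) → Admissible n r H → m ≤ numEdges H)

{-# OPTIONS --safe #-}
module Submission where

-- Lower bound.  If no r − 1 vertices cover H, the greedy cover, whose every step keeps at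
-- most the fraction 1 − r/n of the edges, has not finished after r − 1 steps; hence
-- n^(r−1) ≤ m (n − r)^(r−1).
--
-- Upper bound.  For n = O(r) all r-subsets of 2r − 1 points will do.  Otherwise take a prime q
-- of order n/r.  Blow up the points of the projective plane of order q into sets of 2t − 1
-- points, where t is about r/q; an edge consists of t-sets at the points of a line, the same
-- one at all but one of these points.  This is a t(q+1)-uniform intersecting family with at
-- most 2q²·16^t edges.  A set T of fewer than t(q+1) vertices contains fewer than t copies of
-- some point u, and, as the q + 1 lines through u are disjoint outside u, T has fewer than t
-- vertices over one of these lines outside u; so T misses an edge on this line.  The remaining
-- d = r − t(q+1) is made up for by adding r rows of d vertices: the edges are then the old ones
-- extended by a row, and poly(q) transversals of the rows.

open import Defs
open import Data.Bool using (Bool; true; false; _∧_; _∨_; not; if_then_else_) renaming (_≟_ to _≟ᵇ_)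
open import Data.Fin using (Fin; zero; suc; toℕ; fromℕ<; inject≤; combine; remQuot; splitAt; _↑ˡ_; _↑ʳ_)
open import Data.Fin.Properties using (splitAt-↑ˡ; splitAt-↑ʳ; splitAt⁻¹-↑ˡ; splitAt⁻¹-↑ʳ; remQuot-combine; combine-remQuot; toℕ-fromℕ<; toℕ-injective; toℕ<n; inject≤-injective) renaming (_≟_ to _≟ᶠ_)
open import Data.Fin.Subset using (Subset; _∩_; _∪_; ∣_∣; Nonempty; ⁅_⁆; inside; outside) renaming (⊥ to ∅)
open import Data.Fin.Subset.Properties using (x∈p∩q⁺; x∈p∩q⁻; nonempty?; anySubset?; ∣⊥∣≡0; ∣⁅x⁆∣≡1; x∈⁅x⁆; p⊆p∪q; q⊆p∪q)
open import Data.List using (List; []; _∷_; _++_; map; length; filter; deduplicate; cartesianProductWith; allFin)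
open import Data.List.Membership.Propositional using (_∈_; lose)
open import Data.List.Membership.Propositional.Properties using (∈-map⁺; ∈-map⁻; ∈-++⁺ˡ; ∈-++⁺ʳ; ∈-cartesianProductWith⁺; ∈-allFin; ∈-deduplicate⁺; ∈-deduplicate⁻; ∈-filter⁺; ∈-filter⁻)
open import Data.List.Properties using (length-map; length-++; length-tabulate; length-deduplicate)
open import Data.List.Relation.Unary.All as All using (All; []; _∷_; all?)
open import Data.List.Relation.Unary.Any using (Any; here; there; any?; satisfied)
open import Data.List.Relation.Unary.Unique.DecPropositional using (unique?)
open import Data.List.Relation.Unary.Unique.DecPropositional.Properties using (deduplicate-!)
open import Data.List.Relation.Unary.Unique.Propositional using (Unique)
open import Data.Nat
open import Data.Nat.Combinatorics using (_C_; nCk+nC[k+1]≡[n+1]C[k+1]; nCn≡1; nC1≡n; nCk≡nC[n∸k]; nCk≡n!/k![n-k]!; k![n∸k]!∣n!; k>n⇒nCk≡0)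
open import Data.Nat.Coprimality using (Coprime; coprime-divisor; prime⇒coprime; coprime-Bézout) renaming (sym to coprime-sym)
open import Data.Nat.DivMod
open import Data.Nat.Divisibility
open import Data.Nat.GCD using (module Bézout)
open import Data.Nat.Induction using (<-rec)
open import Data.Nat.Primality
open import Data.Nat.Primality.Factorisation using (factorise)
open import Data.Nat.Properties
open import Data.Nat.Tactic.RingSolver using (solve-∀)
open import Data.Product as Product using (Σ; ∃; ∃₂; _×_; _,_; proj₁; proj₂)
open import Data.Sum using (_⊎_; inj₁; inj₂; [_,_]′)
open import Data.Vec using (Vec; []; _∷_; lookup; tabulate; toList; fromList)
open import Data.Vec.Properties using (lookup∘tabulate; lookup⇒[]=; []=⇒lookup; ≡-dec; toList∘fromList; length-toList)
open import Function using (_∘_; id)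
open import Relation.Binary.Definitions using (DecidableEquality; tri<; tri≈; tri>)
open import Relation.Binary.PropositionalEquality hiding ([_])
open import Relation.Nullary using (¬_; Dec; yes; no; contradiction; does; _×-dec_)
open import Relation.Nullary.Decidable using (map′)
open import Relation.Unary using (Decidable)
open import Algebra.Properties.CommutativeMonoid.Sum +-0-commutativeMonoid using (sum; ∑-distrib-+)

-- Finite types built from Fin by sums and products

-- With q of order n/r and t of order r/q, the exponent r²/n is of order t, so the target is q^O(t)
-- edges. Blocks (t-sets) chosen independently at the points of a line would cost 2^Θ(tq) edges. One
-- block for a whole line would need a line with fewer than t vertices of T, but averaging over all
-- q² + q + 1 lines only gives the bound t(q+1)²/(q² + q + 1), slightly above t. A block of its own
-- at one point closes this gap and merely squares the number of choices.
--
-- Old edges extended by rows would still be covered by the t(q+1) vertices of a single old edge;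
-- the transversals are there to force d more.
--
-- The prime q matters only up to a constant factor, so a crude substitute for Bertrand's postulate
-- is enough: lcm(1, ..., N) is at least 2^(N/2), whereas without primes in (N/16, N] it would be at
-- most N^(√N) · 4^(N/16).

infixr 5 _⊕_
infixr 6 _⊗_

-- Vertices keep their geometric coordinates, so that counting is done by iterated sums; they are
-- numbered by `Fin` only in the passage to hypergraphs.
data Shape : Set where
  fin     : ℕ → Shape
  _⊕_ _⊗_ : Shape → Shape → Shape

El : Shape → Set
El (fin n) = Fin n
El (s ⊕ u) = El s ⊎ El u
El (s ⊗ u) = El s × El u

size : Shape → ℕ
size (fin n) = n
size (s ⊕ u) = size s + size u
size (s ⊗ u) = size s * size u

∑ : ∀ s → (El s → ℕ) → ℕ
∑ (fin n) f = sum f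
∑ (s ⊕ u) f = ∑ s (f ∘ inj₁) + ∑ u (f ∘ inj₂)
∑ (s ⊗ u) f = ∑ s λ x → ∑ u λ y → f (x , y)

∑-mono : ∀ s {f g : El s → ℕ} → (∀ x → f x ≤ g x) → ∑ s f ≤ ∑ s g
∑-mono (fin zero)    f≤g = z≤n
∑-mono (fin (suc n)) f≤g = +-mono-≤ (f≤g zero) (∑-mono (fin n) (f≤g ∘ suc))
∑-mono (s ⊕ u) f≤g = +-mono-≤ (∑-mono s (f≤g ∘ inj₁)) (∑-mono u (f≤g ∘ inj₂))
∑-mono (s ⊗ u) f≤g = ∑-mono s λ x → ∑-mono u λ y → f≤g (x , y)

∑-cong : ∀ s {f g : El s → ℕ} → (∀ x → f x ≡ g x) → ∑ s f ≡ ∑ s g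
∑-cong s f≡g = ≤-antisym (∑-mono s (≤-reflexive ∘ f≡g)) (∑-mono s (≤-reflexive ∘ sym ∘ f≡g))

∑-const : ∀ s c → ∑ s (λ _ → c) ≡ size s * c
∑-const (fin zero)    c = refl
∑-const (fin (suc n)) c = cong (c +_) (∑-const (fin n) c)
∑-const (s ⊕ u) c = trans (cong₂ _+_ (∑-const s c) (∑-const u c)) (sym (*-distribʳ-+ c (size s) (size u)))
∑-const (s ⊗ u) c = trans (∑-cong s λ _ → ∑-const u c) (trans (∑-const s (size u * c)) (sym (*-assoc (size s) (size u) c)))

∑-+ : ∀ s (f g : El s → ℕ) → ∑ s (λ x → f x + g x) ≡ ∑ s f + ∑ s g
∑-+ (fin n) f g = ∑-distrib-+ f g
∑-+ (s ⊕ u) f g = trans (cong₂ _+_ (∑-+ s (f ∘ inj₁) (g ∘ inj₁)) (∑-+ u (f ∘ inj₂) (g ∘ inj₂)))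
  (interchange (∑ s (f ∘ inj₁)) _ _ _)
  where
  interchange : ∀ a b c d → (a + b) + (c + d) ≡ (a + c) + (b + d)
  interchange a b c d = trans (+-assoc a b _) (trans (cong (a +_) (trans (sym (+-assoc b c d)) (trans (cong (_+ d) (+-comm b c)) (+-assoc c b d)))) (sym (+-assoc a c _)))
∑-+ (s ⊗ u) f g = trans (∑-cong s λ x → ∑-+ u _ _) (∑-+ s _ _)

∑-swap : ∀ s u (f : El s → El u → ℕ) → ∑ s (λ x → ∑ u (f x)) ≡ ∑ u (λ y → ∑ s (λ x → f x y))
∑-swap (fin zero)    u f = sym (trans (∑-const u 0) (*-zeroʳ (size u)))
∑-swap (fin (suc n)) u f = trans (cong (∑ u (f zero) +_) (∑-swap (fin n) u (f ∘ suc))) (sym (∑-+ u _ _))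
∑-swap (s ⊕ s′) u f = trans (cong₂ _+_ (∑-swap s u (f ∘ inj₁)) (∑-swap s′ u (f ∘ inj₂))) (sym (∑-+ u _ _))
∑-swap (s ⊗ s′) u f = trans (∑-cong s λ x → ∑-swap s′ u (λ y → f (x , y))) (∑-swap s u _)

≤∑ : ∀ s (f : El s → ℕ) x → f x ≤ ∑ s f
≤∑ (fin (suc n)) f zero    = m≤m+n _ _
≤∑ (fin (suc n)) f (suc i) = ≤-trans (≤∑ (fin n) (f ∘ suc) i) (m≤n+m _ _)
≤∑ (s ⊕ u) f (inj₁ x) = ≤-trans (≤∑ s (f ∘ inj₁) x) (m≤m+n _ _)
≤∑ (s ⊕ u) f (inj₂ y) = ≤-trans (≤∑ u (f ∘ inj₂) y) (m≤n+m _ _)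
≤∑ (s ⊗ u) f (x , y) = ≤-trans (≤∑ u (λ z → f (x , z)) y) (≤∑ s _ x)

all-or-some : ∀ s {P Q : El s → Set} → (∀ x → P x ⊎ Q x) → (∀ x → P x) ⊎ ∃ Q
all-or-some (fin zero)    d = inj₁ λ ()
all-or-some (fin (suc n)) d with d zero | all-or-some (fin n) (d ∘ suc)
... | inj₂ q | _            = inj₂ (zero , q)
... | inj₁ p | inj₂ (i , q) = inj₂ (suc i , q)
... | inj₁ p | inj₁ ps      = inj₁ λ { zero → p ; (suc i) → ps i }
all-or-some (s ⊕ u) d with all-or-some s (d ∘ inj₁) | all-or-some u (d ∘ inj₂)
... | inj₂ (x , q) | _            = inj₂ (inj₁ x , q)
... | inj₁ ps      | inj₂ (y , q) = inj₂ (inj₂ y , q)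
... | inj₁ ps      | inj₁ ps′     = inj₁ λ { (inj₁ x) → ps x ; (inj₂ y) → ps′ y }
all-or-some (s ⊗ u) {P} {Q} d with all-or-some s {λ x → ∀ y → P (x , y)} {λ x → ∃ λ y → Q (x , y)} (λ x → all-or-some u λ y → d (x , y))
... | inj₁ ps          = inj₁ λ (x , y) → ps x y
... | inj₂ (x , y , q) = inj₂ ((x , y) , q)

averaging : ∀ s c (f : El s → ℕ) → ∑ s f < c * size s → ∃ λ x → f x < c
averaging s c f f< with all-or-some s {λ x → c ≤ f x} {λ x → f x < c} (λ x → ≤-<-connex c (f x))
... | inj₂ found = found
... | inj₁ all   = contradiction f< (≤⇒≯ (subst (_≤ ∑ s f) (trans (∑-const s c) (*-comm (size s) c)) (∑-mono s all)))

-- Subsets of a shape are Boolean functions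

[_] : Bool → ℕ
[ true ]  = 1
[ false ] = 0

card : ∀ s → (El s → Bool) → ℕ
card s A = ∑ s ([_] ∘ A)

_==_ : ∀ {n} → Fin n → Fin n → Bool
i == j = does (i ≟ᶠ j)

==-refl : ∀ {n} (i : Fin n) → (i == i) ≡ true
==-refl i with i ≟ᶠ i
... | yes _  = refl
... | no i≢i = contradiction refl i≢i

==⇒≡ : ∀ {n} {i j : Fin n} → (i == j) ≡ true → i ≡ j
==⇒≡ {i = i} {j} eq with i ≟ᶠ j
... | yes i≡j = i≡j

∧-true : ∀ {a b} → a ∧ b ≡ true → a ≡ true × b ≡ true
∧-true {true} {true} _ = refl , refl

suc==suc : ∀ {n} (i j : Fin n) → (Fin.suc i == suc j) ≡ (i == j)
suc==suc i j with i ≟ᶠ j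
... | yes _ = refl
... | no  _ = refl

∑-fibre : ∀ {n} (j : Fin n) (f : Fin n → ℕ) → sum (λ i → if i == j then f i else 0) ≡ f j
∑-fibre {suc n} zero f = trans (cong (f zero +_) (trans (∑-const (fin n) 0) (*-zeroʳ n))) (+-identityʳ _)
∑-fibre {suc n} (suc j) f = trans
  (∑-cong (fin n) (λ i → cong (λ b → if b then f (suc i) else 0) (suc==suc i j))) (∑-fibre j (f ∘ suc))

[∧] : ∀ a b → [ a ∧ b ] ≡ (if a then [ b ] else 0)
[∧] true  b = refl
[∧] false b = refl

∑-if : ∀ s a (f : El s → ℕ) → ∑ s (λ x → if a then f x else 0) ≡ (if a then ∑ s f else 0)
∑-if s true  f = refl
∑-if s false f = trans (∑-const s 0) (*-zeroʳ (size s))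

-- Each `f (σ i)` is a sum supported on the one vertex `σ i`. After exchanging the sums, injectivity
-- leaves at most one term for every `v`.
sum-injective : ∀ {m n} (σ : Fin m → Fin n) → (∀ {i j} → σ i ≡ σ j → i ≡ j) →
                (f : Fin n → ℕ) → sum (f ∘ σ) ≤ sum f
sum-injective {m} {n} σ inj f = begin
  sum (f ∘ σ)                                          ≡⟨ ∑-cong (fin m) (λ i → ∑-fibre (σ i) f) ⟨
  sum (λ i → sum λ v → if v == σ i then f v else 0)    ≡⟨ ∑-swap (fin m) (fin n) _ ⟩
  sum (λ v → sum λ i → if v == σ i then f v else 0)    ≤⟨ ∑-mono (fin n) fibre ⟩
  sum f ∎
  where
  open ≤-Reasoning
  fibre : ∀ v → sum (λ i → if v == σ i then f v else 0) ≤ f v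
  fibre v with all-or-some (fin m) {λ i → (v == σ i) ≡ false} {λ i → (v == σ i) ≡ true} (λ i → bool (v == σ i))
    where
    bool : ∀ b → b ≡ false ⊎ b ≡ true
    bool false = inj₁ refl
    bool true  = inj₂ refl
  ... | inj₁ none = begin
    sum (λ i → if v == σ i then f v else 0) ≡⟨ ∑-cong (fin m) (λ i → cong (λ b → if b then f v else 0) (none i)) ⟩
    sum {m} (λ _ → 0)                       ≡⟨ trans (∑-const (fin m) 0) (*-zeroʳ m) ⟩
    0                                       ≤⟨ z≤n ⟩
    f v ∎
  ... | inj₂ (i , v≡σi) = begin
    sum (λ j → if v == σ j then f v else 0) ≤⟨ ∑-mono (fin m) only-i ⟩
    sum (λ j → if j == i then f v else 0)   ≡⟨ ∑-fibre i (λ _ → f v) ⟩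
    f v ∎
    where
    only-i : ∀ j → (if v == σ j then f v else 0) ≤ (if j == i then f v else 0)
    only-i j with v == σ j in eq
    ... | false = z≤n
    ... | true rewrite inj {j} {i} (trans (sym (==⇒≡ {i = v} eq)) (==⇒≡ {i = v} v≡σi)) | ==-refl i = ≤-refl

card<1⇒empty : ∀ s (A : El s → Bool) → card s A < 1 → ∀ x → A x ≡ false
card<1⇒empty s A A<1 x with A x in eq
... | false = refl
... | true  = contradiction (≤-<-trans (subst (λ b → [ b ] ≤ card s A) eq (≤∑ s ([_] ∘ A) x)) A<1) λ { (s≤s ()) }

-- For disjoint sets `[ A x ] + [ B x ] ≤ 1` everywhere, and summing would contradict the sizes.
meet-large : ∀ s (A B : El s → Bool) → size s < card s A + card s B → ∃ λ x → A x ≡ true × B x ≡ true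
meet-large s A B large with all-or-some s {λ x → [ A x ] + [ B x ] ≤ 1} {λ x → A x ≡ true × B x ≡ true} (λ x → bool (A x) (B x))
  where
  bool : ∀ a b → [ a ] + [ b ] ≤ 1 ⊎ (a ≡ true × b ≡ true)
  bool true  true  = inj₂ (refl , refl)
  bool true  false = inj₁ ≤-refl
  bool false true  = inj₁ ≤-refl
  bool false false = inj₁ z≤n
... | inj₂ found = found
... | inj₁ small = contradiction large (≤⇒≯ (begin
  card s A + card s B           ≡⟨ ∑-+ s ([_] ∘ A) ([_] ∘ B) ⟨
  ∑ s (λ x → [ A x ] + [ B x ]) ≤⟨ ∑-mono s small ⟩
  ∑ s (λ _ → 1)                 ≡⟨ ∑-const s 1 ⟩
  size s * 1                    ≡⟨ *-identityʳ (size s) ⟩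
  size s                        ∎))
  where open ≤-Reasoning

⋁ : ∀ {n} → (Fin n → Bool) → Bool
⋁ {zero}  A = false
⋁ {suc n} A = A zero ∨ ⋁ (A ∘ suc)

⋁-false : ∀ {n} (A : Fin n → Bool) → ⋁ A ≡ false → ∀ i → A i ≡ false
⋁-false {suc n} A ⋁≡ i with A zero in eq
⋁-false {suc n} A ⋁≡ zero    | false = eq
⋁-false {suc n} A ⋁≡ (suc i) | false = ⋁-false (A ∘ suc) ⋁≡ i

[⋁]≤ : ∀ {n} (A : Fin n → Bool) → [ ⋁ A ] ≤ sum ([_] ∘ A)
[⋁]≤ {zero}  A = z≤n
[⋁]≤ {suc n} A with A zero
... | true  = s≤s z≤n
... | false = [⋁]≤ (A ∘ suc)

-- A union bound. It lets one block serve at many points of a line: the block has to avoid the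
-- projection of `T`, which is no larger than that part of `T`.
card-projection : ∀ {n m} (A : Fin n → Fin m → Bool) →
                  card (fin m) (λ i → ⋁ λ v → A v i) ≤ sum (λ v → card (fin m) (A v))
card-projection {n} {m} A = ≤-trans (∑-mono (fin m) λ i → [⋁]≤ (λ v → A v i))
  (≤-reflexive (∑-swap (fin m) (fin n) (λ i v → [ A v i ])))

-- Numbering a shape, and complete lists of finite types

toFin : ∀ s → El s → Fin (size s)
toFin (fin n) i        = i
toFin (s ⊕ u) (inj₁ x) = toFin s x ↑ˡ size u
toFin (s ⊕ u) (inj₂ y) = size s ↑ʳ toFin u y
toFin (s ⊗ u) (x , y)  = combine (toFin s x) (toFin u y)

fromFin : ∀ s → Fin (size s) → El s
fromFin (fin n) i = i
fromFin (s ⊕ u) i with splitAt (size s) i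
... | inj₁ j = inj₁ (fromFin s j)
... | inj₂ j = inj₂ (fromFin u j)
fromFin (s ⊗ u) i = Product.map (fromFin s) (fromFin u) (remQuot (size u) i)

from-to : ∀ s x → fromFin s (toFin s x) ≡ x
from-to (fin n) i = refl
from-to (s ⊕ u) (inj₁ x) rewrite splitAt-↑ˡ (size s) (toFin s x) (size u) = cong inj₁ (from-to s x)
from-to (s ⊕ u) (inj₂ y) rewrite splitAt-↑ʳ (size s) (size u) (toFin u y) = cong inj₂ (from-to u y)
from-to (s ⊗ u) (x , y) = trans
  (cong (Product.map (fromFin s) (fromFin u)) (remQuot-combine (toFin s x) (toFin u y)))
  (cong₂ _,_ (from-to s x) (from-to u y))

sum-++ : ∀ m n (f : Fin (m + n) → ℕ) → sum f ≡ sum (λ i → f (i ↑ˡ n)) + sum (λ j → f (m ↑ʳ j))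
sum-++ zero    n f = refl
sum-++ (suc m) n f = trans (cong (f zero +_) (sum-++ m n (f ∘ suc))) (sym (+-assoc (f zero) _ _))

sum-combine : ∀ m n (f : Fin (m * n) → ℕ) → sum f ≡ sum {m} (λ i → sum {n} (λ j → f (combine i j)))
sum-combine zero    n f = refl
sum-combine (suc m) n f = trans (sum-++ n (m * n) f) (cong (sum (λ i → f (i ↑ˡ (m * n))) +_) (sum-combine m n _))

∑-toFin : ∀ s (f : Fin (size s) → ℕ) → ∑ s (f ∘ toFin s) ≡ sum f
∑-toFin (fin n) f = refl
∑-toFin (s ⊕ u) f = trans (cong₂ _+_ (∑-toFin s (λ i → f (i ↑ˡ size u))) (∑-toFin u (λ j → f (size s ↑ʳ j)))) (sym (sum-++ (size s) (size u) f))
∑-toFin (s ⊗ u) f = trans (∑-cong s λ x → ∑-toFin u (λ j → f (combine (toFin s x) j)))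
  (trans (∑-toFin s (λ i → sum (λ j → f (combine i j)))) (sym (sum-combine (size s) (size u) f)))

∑-fromFin : ∀ s (f : El s → ℕ) → sum (f ∘ fromFin s) ≡ ∑ s f
∑-fromFin s f = trans (sym (∑-toFin s (f ∘ fromFin s))) (∑-cong s λ x → cong f (from-to s x))

to-from : ∀ s i → toFin s (fromFin s i) ≡ i
to-from (fin n) i = refl
to-from (s ⊕ u) i with splitAt (size s) i in eq
... | inj₁ j = trans (cong (_↑ˡ size u) (to-from s j)) (splitAt⁻¹-↑ˡ eq)
... | inj₂ j = trans (cong (size s ↑ʳ_) (to-from u j)) (splitAt⁻¹-↑ʳ eq)
to-from (s ⊗ u) i = trans (cong₂ combine (to-from s _) (to-from u _)) (combine-remQuot {size s} (size u) i)

-- Repetitions are allowed, so `k` bounds the number of elements from above. This suffices, since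
-- constructed edges are only counted from above.
record Listing (A : Set) (k : ℕ) : Set where
  field
    items    : List A
    complete : ∀ a → a ∈ items
    length≡  : length items ≡ k
open Listing

length-cartesianProductWith : ∀ {A B C : Set} (f : A → B → C) xs ys →
  length (cartesianProductWith f xs ys) ≡ length xs * length ys
length-cartesianProductWith f []       ys = refl
length-cartesianProductWith f (x ∷ xs) ys = trans (length-++ (map (f x) ys))
  (cong₂ _+_ (length-map (f x) ys) (length-cartesianProductWith f xs ys))

list-Fin : ∀ n → Listing (Fin n) n
list-Fin n = record { items = allFin n ; complete = ∈-allFin ; length≡ = length-tabulate id }

list-× : ∀ {A B : Set} {a b} → Listing A a → Listing B b → Listing (A × B) (a * b)
list-× l m = record
  { items    = cartesianProductWith _,_ (items l) (items m)
  ; complete = λ (x , y) → ∈-cartesianProductWith⁺ _,_ (complete l x) (complete m y)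
  ; length≡  = trans (length-cartesianProductWith _,_ (items l) (items m)) (cong₂ _*_ (length≡ l) (length≡ m))
  }

list-⊎ : ∀ {A B : Set} {a b} → Listing A a → Listing B b → Listing (A ⊎ B) (a + b)
list-⊎ l m = record
  { items    = map inj₁ (items l) ++ map inj₂ (items m)
  ; complete = λ { (inj₁ x) → ∈-++⁺ˡ (∈-map⁺ inj₁ (complete l x))
                 ; (inj₂ y) → ∈-++⁺ʳ (map inj₁ (items l)) (∈-map⁺ inj₂ (complete m y)) }
  ; length≡  = trans (length-++ (map inj₁ (items l)))
      (cong₂ _+_ (trans (length-map inj₁ (items l)) (length≡ l)) (trans (length-map inj₂ (items m)) (length≡ m)))
  }

list-Vec : ∀ {A : Set} {a} → Listing A a → ∀ n → Listing (Vec A n) (a ^ n)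
list-Vec l zero    = record { items = [] ∷ [] ; complete = λ { [] → here refl } ; length≡ = refl }
list-Vec l (suc n) = record
  { items    = cartesianProductWith _∷_ (items l) (items (list-Vec l n))
  ; complete = λ { (x ∷ xs) → ∈-cartesianProductWith⁺ _∷_ (complete l x) (complete (list-Vec l n) xs) }
  ; length≡  = trans (length-cartesianProductWith _∷_ (items l) (items (list-Vec l n)))
      (cong₂ _*_ (length≡ l) (length≡ (list-Vec l n)))
  }

list-Bool : Listing Bool 2
list-Bool = record
  { items = true ∷ false ∷ [] ; complete = λ { true → here refl ; false → there (here refl) } ; length≡ = refl }

list-El : ∀ s → Listing (El s) (size s)
list-El (fin n) = list-Fin n
list-El (s ⊕ u) = list-⊎ (list-El s) (list-El u)
list-El (s ⊗ u) = list-× (list-El s) (list-El u)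

-- Different indices may name the same edge, so M only bounds the number of edges.
record System (s : Shape) (r M : ℕ) : Set₁ where
  field
    Index   : Set
    listing : Listing Index M
    edge    : Index → El s → Bool
    uniform : ∀ i → card s (edge i) ≡ r
    meet    : ∀ i j → ∃ λ v → edge i v ≡ true × edge j v ≡ true
    avoid   : ∀ T → card s T < r → ∃ λ i → ∀ v → edge i v ≡ true → T v ≡ false
open System

-- All t-subsets of 2t − 1 points

-- Truncation turns any large enough set into a `t`-set, so that blocks can be indexed by all
-- Boolean vectors, at the cost of repetitions only.
firsts : ∀ {m} → ℕ → Vec Bool m → Vec Bool m
firsts t       []          = []
firsts zero    (b ∷ A)     = false ∷ firsts zero A
firsts (suc t) (true ∷ A)  = true ∷ firsts t A
firsts (suc t) (false ∷ A) = false ∷ firsts (suc t) A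

firsts-⊆ : ∀ {m} t (A : Vec Bool m) i → lookup (firsts t A) i ≡ true → lookup A i ≡ true
firsts-⊆ zero    (b ∷ A)     (suc i) eq = firsts-⊆ zero A i eq
firsts-⊆ (suc t) (true ∷ A)  zero    eq = refl
firsts-⊆ (suc t) (true ∷ A)  (suc i) eq = firsts-⊆ t A i eq
firsts-⊆ (suc t) (false ∷ A) (suc i) eq = firsts-⊆ (suc t) A i eq

card-firsts : ∀ {m} t (A : Vec Bool m) → t ≤ card (fin m) (lookup A) → card (fin m) (lookup (firsts t A)) ≡ t
card-firsts zero    []          _ = refl
card-firsts zero    (b ∷ A)     _ = card-firsts zero A z≤n
card-firsts (suc t) (true ∷ A)  (s≤s t≤) = cong suc (card-firsts t A t≤)
card-firsts (suc t) (false ∷ A) t≤ = card-firsts (suc t) A t≤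

card-not : ∀ s (A : El s → Bool) → card s A + card s (not ∘ A) ≡ size s
card-not s A = trans (sym (∑-+ s _ _)) (trans (∑-cong s λ x → bool (A x)) (trans (∑-const s 1) (*-identityʳ (size s))))
  where
  bool : ∀ b → [ b ] + [ not b ] ≡ 1
  bool true  = refl
  bool false = refl

module Block (t : ℕ) (0<t : 0 < t) where

  -- The size `2t − 1` is forced from both sides: two `t`-sets must meet, and the complement of any
  -- `t − 1` points must contain a `t`-set.
  m : ℕ
  m = pred (2 * t)

  1+m≡2t : suc m ≡ 2 * t
  1+m≡2t = suc-pred (2 * t) {{m*n≢0 2 t {{_}} {{>-nonZero 0<t}}}}

  t≤m : t ≤ m
  t≤m = s≤s⁻¹ (begin
    suc t  ≡⟨ +-comm 1 t ⟩
    t + 1  ≤⟨ +-monoʳ-≤ t 0<t ⟩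
    t + t  ≡⟨ cong (t +_) (+-identityʳ t) ⟨
    2 * t  ≡⟨ 1+m≡2t ⟨
    suc m  ∎)
    where open ≤-Reasoning

  all : Vec Bool m
  all = tabulate λ _ → true

  card-all : card (fin m) (lookup all) ≡ m
  card-all = trans (∑-cong (fin m) λ i → cong [_] (lookup∘tabulate (λ _ → true) i)) (trans (∑-const (fin m) 1) (*-identityʳ m))

  -- If A has fewer than t elements, it names a default t-set.
  block : Vec Bool m → Fin m → Bool
  block A with t ≤? card (fin m) (lookup A)
  ... | yes _ = lookup (firsts t A)
  ... | no  _ = lookup (firsts t all)

  card-block : ∀ A → card (fin m) (block A) ≡ t
  card-block A with t ≤? card (fin m) (lookup A)
  ... | yes t≤A = card-firsts t A t≤A
  ... | no  _   = card-firsts t all (subst (t ≤_) (sym card-all) t≤m)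

  block-meet : ∀ A B → ∃ λ i → block A i ≡ true × block B i ≡ true
  block-meet A B = meet-large (fin m) (block A) (block B) (begin-strict
    m      <⟨ n<1+n m ⟩
    suc m  ≡⟨ 1+m≡2t ⟩
    2 * t  ≡⟨ cong (t +_) (+-identityʳ t) ⟩
    t + t  ≡⟨ cong₂ _+_ (card-block A) (card-block B) ⟨
    card (fin m) (block A) + card (fin m) (block B) ∎)
    where open ≤-Reasoning

  -- The complement of `T` has at least `2t − 1 − (t − 1) = t` points, so `block` truncates it and
  -- does not fall back on the default.
  block-avoid : ∀ T → card (fin m) T < t → ∃ λ A → ∀ i → block A i ≡ true → T i ≡ false
  block-avoid T T<t = A , avoids
    where
    A = tabulate (not ∘ T)
    card-A : card (fin m) (lookup A) ≡ card (fin m) (not ∘ T)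
    card-A = ∑-cong (fin m) λ i → cong [_] (lookup∘tabulate (not ∘ T) i)
    t≤A : t ≤ card (fin m) (lookup A)
    t≤A = subst (t ≤_) (sym card-A) (+-cancelˡ-≤ t t _ (begin
      t + t                                    ≡⟨ cong (t +_) (+-identityʳ t) ⟨
      2 * t                                    ≡⟨ 1+m≡2t ⟨
      suc m                                    ≡⟨ cong suc (card-not (fin m) T) ⟨
      suc (card (fin m) T + card (fin m) (not ∘ T)) ≤⟨ +-monoˡ-≤ (card (fin m) (not ∘ T)) T<t ⟩
      t + card (fin m) (not ∘ T)               ∎))
      where open ≤-Reasoning
    not-true : ∀ b → not b ≡ true → b ≡ false
    not-true false _ = refl
    avoids : ∀ i → block A i ≡ true → T i ≡ false
    avoids i eq with t ≤? card (fin m) (lookup A)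
    ... | yes _  = not-true (T i) (trans (sym (lookup∘tabulate (not ∘ T) i)) (firsts-⊆ t A i eq))
    ... | no t≰A = contradiction t≤A t≰A

  list-blocks : Listing (Vec Bool m) (2 ^ m)
  list-blocks = list-Vec list-Bool m

completeSystem : ∀ r → 0 < r → System (fin (pred (2 * r))) r (2 ^ pred (2 * r))
completeSystem r 0<r = record
  { Index = Vec Bool m ; listing = list-blocks ; edge = block ; uniform = card-block ; meet = block-meet ; avoid = block-avoid }
  where open Block r 0<r

-- Lines of the affine plane over ℤ/q

module Lines (q : ℕ) (q-prime : Prime q) where

  instance
    q≢0 : NonZero q
    q≢0 = prime⇒nonZero q-prime

  mod : ℕ → Fin q
  mod k = fromℕ< (m%n<n k q)

  toℕ-mod : ∀ k → toℕ (mod k) ≡ k % q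
  toℕ-mod k = toℕ-fromℕ< (m%n<n k q)

  -- Column 0 is the line at infinity, whose points are the slopes.
  line : Fin q → Fin q → Fin (suc q) → Fin q
  line a b zero    = a
  line a b (suc x) = mod (toℕ a * toℕ x + toℕ b)

  +%-cong : ∀ c {k l} → k % q ≡ l % q → (c + k) % q ≡ (c + l) % q
  +%-cong c {k} {l} eq = begin
    (c + k) % q             ≡⟨ %-distribˡ-+ c k q ⟩
    (c % q + k % q) % q     ≡⟨ cong (λ z → (c % q + z) % q) eq ⟩
    (c % q + l % q) % q     ≡⟨ %-distribˡ-+ c l q ⟨
    (c + l) % q             ∎
    where open ≡-Reasoning

  -- Modulo `q`, adding `c * pred q` is subtracting `c`.
  +%-cancel : ∀ c {k l} → (c + k) % q ≡ (c + l) % q → k % q ≡ l % q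
  +%-cancel c {k} {l} eq = begin
    k % q                         ≡⟨ clear k ⟨
    (c * pred q + (c + k)) % q    ≡⟨ +%-cong (c * pred q) eq ⟩
    (c * pred q + (c + l)) % q    ≡⟨ clear l ⟩
    l % q                         ∎
    where
    open ≡-Reasoning
    regroup : ∀ c p k → c * p + (c + k) ≡ k + c * suc p
    regroup = solve-∀
    clear : ∀ k → (c * pred q + (c + k)) % q ≡ k % q
    clear k = trans (cong (_% q) (trans (regroup c (pred q) k) (cong (λ z → k + c * z) (suc-pred q)))) ([m+kn]%n≡m%n k c q)

  line-injective : ∀ a x {b b′} → line a b (suc x) ≡ line a b′ (suc x) → b ≡ b′
  line-injective a x {b} {b′} eq = toℕ-injective (begin
    toℕ b         ≡⟨ m<n⇒m%n≡m (toℕ<n b) ⟨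
    toℕ b % q     ≡⟨ +%-cancel (toℕ a * toℕ x) (trans (sym (toℕ-mod _)) (trans (cong toℕ eq) (toℕ-mod _))) ⟩
    toℕ b′ % q    ≡⟨ m<n⇒m%n≡m (toℕ<n b′) ⟩
    toℕ b′        ∎)
    where open ≡-Reasoning

  -- Bézout's identity over ℕ has two forms. In the second the inverse of `δ` is -y, represented by
  -- `y * pred q`; multiples of `q` on both sides avoid subtraction.
  inverse : ∀ δ → 0 < δ → δ < q → ∃₂ λ i k → ∃ λ l → i * δ + k * q ≡ 1 + l * q
  inverse δ 0<δ δ<q with coprime-Bézout (prime⇒coprime q-prime {{>-nonZero 0<δ}} δ<q)
  ... | Bézout.-+ x y eq = y , 0 , x , trans (+-identityʳ _) (sym eq)
  ... | Bézout.+- x y eq = y * pred q , x , y * δ , (begin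
    y * pred q * δ + x * q           ≡⟨ cong (y * pred q * δ +_) eq ⟨
    y * pred q * δ + (1 + y * δ)     ≡⟨ regroup y (pred q) δ ⟩
    1 + y * δ * suc (pred q)         ≡⟨ cong (λ z → 1 + y * δ * z) (suc-pred q) ⟩
    1 + y * δ * q                    ∎)
    where
    open ≡-Reasoning
    regroup : ∀ y p δ → y * p * δ + (1 + y * δ) ≡ 1 + y * δ * suc p
    regroup = solve-∀

  solve-linear : ∀ δ → 0 < δ → δ < q → ∀ b b′ → ∃ λ (x : Fin q) → (δ * toℕ x + b′) % q ≡ b % q
  solve-linear δ 0<δ δ<q b b′ with i , k , l , eq ← inverse δ 0<δ δ<q = mod X , (begin
    (δ * toℕ (mod X) + b′) % q        ≡⟨ cong (λ z → (δ * z + b′) % q) (toℕ-mod X) ⟩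
    (δ * (X % q) + b′) % q            ≡⟨ [m+kn]%n≡m%n (δ * (X % q) + b′) (δ * (X / q)) q ⟨
    (δ * (X % q) + b′ + δ * (X / q) * q) % q ≡⟨ cong (_% q) (a1 δ (X % q) b′ (X / q) q) ⟩
    (δ * (X % q + X / q * q) + b′) % q ≡⟨ cong (λ z → (δ * z + b′) % q) (m≡m%n+[m/n]*n X q) ⟨
    (δ * X + b′) % q                  ≡⟨ [m+kn]%n≡m%n (δ * X + b′) (k * c) q ⟨
    (δ * X + b′ + k * c * q) % q      ≡⟨ cong (_% q) (a2 δ i c b′ k q) ⟩
    ((i * δ + k * q) * c + b′) % q    ≡⟨ cong (λ z → (z * c + b′) % q) eq ⟩
    ((1 + l * q) * c + b′) % q        ≡⟨ cong (_% q) (trans (a3 l q b b′ (pred q)) (cong (λ z → b + b′ * z + l * c * q) (suc-pred q))) ⟩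
    (b + b′ * q + l * c * q) % q      ≡⟨ [m+kn]%n≡m%n (b + b′ * q) (l * c) q ⟩
    (b + b′ * q) % q                  ≡⟨ [m+kn]%n≡m%n b b′ q ⟩
    b % q                             ∎)
    where
    open ≡-Reasoning
    -- Modulo `q` this is b - b′, so that `X` is (b - b′)/δ.
    c = b + b′ * pred q
    X = i * c
    a1 : ∀ δ r b′ d q → δ * r + b′ + δ * d * q ≡ δ * (r + d * q) + b′
    a1 = solve-∀
    a2 : ∀ δ i c b′ k q → δ * (i * c) + b′ + k * c * q ≡ (i * δ + k * q) * c + b′
    a2 = solve-∀
    a3 : ∀ l q b b′ p → (1 + l * q) * (b + b′ * p) + b′ ≡ b + b′ * suc p + l * (b + b′ * p) * q
    a3 = solve-∀

  -- Equating the two lines gives (a′ - a)x + b′ = b. The order of the slopes keeps their difference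
  -- strictly between 0 and `q`, hence invertible.
  nonparallel-meet : ∀ a b a′ b′ → toℕ a < toℕ a′ → ∃ λ x → line a b (suc x) ≡ line a′ b′ (suc x)
  nonparallel-meet a b a′ b′ a<a′ = x , toℕ-injective (begin
      toℕ (mod (toℕ a * toℕ x + toℕ b))             ≡⟨ toℕ-mod _ ⟩
      (toℕ a * toℕ x + toℕ b) % q                   ≡⟨ +%-cong (toℕ a * toℕ x) (proj₂ solution) ⟨
      (toℕ a * toℕ x + (δ * toℕ x + toℕ b′)) % q    ≡⟨ cong (_% q) (regroup (toℕ a) δ (toℕ x) (toℕ b′)) ⟩
      ((toℕ a + δ) * toℕ x + toℕ b′) % q            ≡⟨ cong (λ z → (z * toℕ x + toℕ b′) % q) (m+[n∸m]≡n (<⇒≤ a<a′)) ⟩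
      (toℕ a′ * toℕ x + toℕ b′) % q                 ≡⟨ toℕ-mod _ ⟨
      toℕ (mod (toℕ a′ * toℕ x + toℕ b′))           ∎)
    where
    open ≡-Reasoning
    δ = toℕ a′ ∸ toℕ a
    solution = solve-linear δ (m<n⇒0<n∸m a<a′) (≤-<-trans (m∸n≤m (toℕ a′) (toℕ a)) (toℕ<n a′)) (toℕ b) (toℕ b′)
    x = proj₁ solution
    regroup : ∀ a δ x b → a * x + (δ * x + b) ≡ (a + δ) * x + b
    regroup = solve-∀

  lines-meet : ∀ a b a′ b′ → ∃ λ c → line a b c ≡ line a′ b′ c
  lines-meet a b a′ b′ with <-cmp (toℕ a) (toℕ a′)
  ... | tri≈ _ a≡a′ _ = zero , toℕ-injective a≡a′
  ... | tri< a<a′ _ _ = let x , eq = nonparallel-meet a b a′ b′ a<a′ in suc x , eq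
  ... | tri> _ _ a>a′ = let x , eq = nonparallel-meet a′ b′ a b a>a′ in suc x , sym eq

  -- Lines of equal slope are disjoint.
  parallel-weights : ∀ (w : Fin (suc q) → Fin q → ℕ) a →
    sum (λ b → sum λ x → w (suc x) (line a b (suc x))) ≤ ∑ (fin (suc q) ⊗ fin q) (λ (c , v) → w c v)
  parallel-weights w a = begin
    sum (λ b → sum λ x → w (suc x) (line a b (suc x)))  ≡⟨ ∑-swap (fin q) (fin q) (λ b x → w (suc x) (line a b (suc x))) ⟩
    sum (λ x → sum λ b → w (suc x) (line a b (suc x)))  ≤⟨ ∑-mono (fin q) (λ x → sum-injective (λ b → line a b (suc x)) (line-injective a x) (w (suc x))) ⟩
    sum (λ x → sum (w (suc x)))                         ≤⟨ m≤n+m _ (sum (w zero)) ⟩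
    ∑ (fin (suc q) ⊗ fin q) (λ (c , v) → w c v)         ∎
    where open ≤-Reasoning

  -- The hypothesis is used twice: the `q` points of column 0 have average weight below `t`, and so
  -- have the `q` lines through the chosen one, which are disjoint outside column 0.
  light-line : ∀ t (w : Fin (suc q) → Fin q → ℕ) → ∑ (fin (suc q) ⊗ fin q) (λ (c , v) → w c v) < t * q →
               ∃₂ λ a b → w zero a < t × sum (λ x → w (suc x) (line a b (suc x))) < t
  light-line t w w<
    with a , wa<t ← averaging (fin q) t (w zero) (≤-<-trans (m≤m+n _ _) w<)
    with b , wb<t ← averaging (fin q) t (λ b → sum λ x → w (suc x) (line a b (suc x)))
                      (≤-<-trans (parallel-weights w a) w<)
    = a , b , wa<t , wb<t

-- The first summand of planeShape is the blown-up common point of the columns.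
module Plane (q : ℕ) (q-prime : Prime q) (t : ℕ) (0<t : 0 < t) where
  open Lines q q-prime
  open Block t 0<t

  planeShape : Shape
  planeShape = fin m ⊕ fin (suc q) ⊗ fin q ⊗ fin m

  -- `inj₁ c` stands for column `c` with the common point and `inj₂ (a , b)` for `line a b`, q² + q
  -- + 1 lines in all. The vectors name the block at the exceptional point and the block elsewhere
  -- on the line.
  PlaneIndex : Set
  PlaneIndex = (Fin (suc q) ⊎ Fin q × Fin q) × Vec Bool m × Vec Bool m

  -- A line missing the common point has its exceptional point in column 0, where `light-line`
  -- bounds the weight separately.
  blockAt : Fin (suc q) → Vec Bool m → Vec Bool m → Fin m → Bool
  blockAt zero    A B = block A
  blockAt (suc _) A B = block B

  card-blockAt : ∀ c A B → card (fin m) (blockAt c A B) ≡ t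
  card-blockAt zero    A B = card-block A
  card-blockAt (suc _) A B = card-block B

  planeEdge : PlaneIndex → El planeShape → Bool
  planeEdge (inj₁ c , A , B)       (inj₁ i)            = block A i
  planeEdge (inj₁ c , A , B)       (inj₂ (c′ , v , i)) = (c′ == c) ∧ block B i
  planeEdge (inj₂ (a , b) , A , B) (inj₁ i)            = false
  planeEdge (inj₂ (a , b) , A , B) (inj₂ (c , v , i))  = (v == line a b c) ∧ blockAt c A B i

  planeUniform : ∀ e → card planeShape (planeEdge e) ≡ suc q * t
  planeUniform (inj₁ c , A , B) = cong₂ _+_ (card-block A) (begin
    sum (λ c′ → ∑ (fin q ⊗ fin m) λ (v , i) → [ (c′ == c) ∧ block B i ])
      ≡⟨ ∑-cong (fin (suc q)) (λ c′ → trans (∑-cong (fin q ⊗ fin m) λ (v , i) → [∧] (c′ == c) (block B i))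
           (∑-if (fin q ⊗ fin m) (c′ == c) (λ (v , i) → [ block B i ]))) ⟩
    sum (λ c′ → if c′ == c then ∑ (fin q ⊗ fin m) (λ (v , i) → [ block B i ]) else 0)
      ≡⟨ ∑-fibre c (λ _ → ∑ (fin q ⊗ fin m) (λ (v , i) → [ block B i ])) ⟩
    sum {q} (λ v → card (fin m) (block B))
      ≡⟨ trans (∑-const (fin q) _) (cong (q *_) (card-block B)) ⟩
    q * t ∎)
    where open ≡-Reasoning
  planeUniform (inj₂ (a , b) , A , B) = cong₂ _+_ (trans (∑-const (fin m) 0) (*-zeroʳ m)) (begin
    sum (λ c → sum λ v → sum λ i → [ (v == line a b c) ∧ blockAt c A B i ])
      ≡⟨ ∑-cong (fin (suc q)) (λ c → ∑-cong (fin q) λ v → trans (∑-cong (fin m) λ i → [∧] (v == line a b c) (blockAt c A B i))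
           (∑-if (fin m) (v == line a b c) ([_] ∘ blockAt c A B))) ⟩
    sum (λ c → sum λ v → if v == line a b c then card (fin m) (blockAt c A B) else 0)
      ≡⟨ ∑-cong (fin (suc q)) (λ c → trans (∑-fibre (line a b c) (λ _ → card (fin m) (blockAt c A B))) (card-blockAt c A B)) ⟩
    sum {suc q} (λ c → t)
      ≡⟨ ∑-const (fin (suc q)) t ⟩
    suc q * t ∎)
    where open ≡-Reasoning

  blockAt-meet : ∀ c A B A′ B′ → ∃ λ i → blockAt c A B i ≡ true × blockAt c A′ B′ i ≡ true
  blockAt-meet zero    A B A′ B′ = block-meet A A′
  blockAt-meet (suc _) A B A′ B′ = block-meet B B′

  block-blockAt-meet : ∀ c D A B → ∃ λ i → block D i ≡ true × blockAt c A B i ≡ true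
  block-blockAt-meet zero    D A B = block-meet D A
  block-blockAt-meet (suc _) D A B = block-meet D B

  planeMeet : ∀ e e′ → ∃ λ v → planeEdge e v ≡ true × planeEdge e′ v ≡ true
  planeMeet (inj₁ c , A , B) (inj₁ c′ , A′ , B′) = let i , x , y = block-meet A A′ in inj₁ i , x , y
  planeMeet (inj₁ c , A , B) (inj₂ (a , b) , A′ , B′) =
    let i , x , y = block-blockAt-meet c B A′ B′
    in inj₂ (c , line a b c , i) , cong₂ _∧_ (==-refl c) x , cong₂ _∧_ (==-refl (line a b c)) y
  planeMeet (inj₂ (a , b) , A , B) (inj₁ c , A′ , B′) =
    let i , x , y = block-blockAt-meet c B′ A B
    in inj₂ (c , line a b c , i) , cong₂ _∧_ (==-refl (line a b c)) y , cong₂ _∧_ (==-refl c) x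
  planeMeet (inj₂ (a , b) , A , B) (inj₂ (a′ , b′) , A′ , B′)
    with c , eq ← lines-meet a b a′ b′
    with i , x , y ← blockAt-meet c A B A′ B′
    = inj₂ (c , line a b c , i) , cong₂ _∧_ (==-refl (line a b c)) x ,
      cong₂ _∧_ (trans (cong (line a b c ==_) (sym eq)) (==-refl (line a b c))) y

  Avoids : (El planeShape → Bool) → PlaneIndex → Set
  Avoids T e = ∀ v → planeEdge e v ≡ true → T v ≡ false

  columnAvoid : ∀ T c → card (fin m) (T ∘ inj₁) < t → card (fin q ⊗ fin m) (λ y → T (inj₂ (c , y))) < t →
                ∃ (Avoids T)
  columnAvoid T c T₁<t Tc<t = (inj₁ c , proj₁ A , proj₁ B) , avoids
    where
    A = block-avoid (T ∘ inj₁) T₁<t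
    B = block-avoid (λ i → ⋁ λ v → T (inj₂ (c , v , i)))
          (≤-<-trans (card-projection λ v i → T (inj₂ (c , v , i))) Tc<t)
    avoids : Avoids T (inj₁ c , proj₁ A , proj₁ B)
    avoids (inj₁ i) eq = proj₂ A i eq
    avoids (inj₂ (c′ , v , i)) eq = trans (cong (λ z → T (inj₂ (z , v , i))) (==⇒≡ {i = c′} (proj₁ (∧-true eq))))
      (⋁-false (λ v → T (inj₂ (c , v , i))) (proj₂ B i (proj₂ (∧-true {c′ == c} eq))) v)

  lineAvoid : ∀ T a b → card (fin m) (λ i → T (inj₂ (zero , a , i))) < t →
              sum (λ x → card (fin m) λ i → T (inj₂ (suc x , line a b (suc x) , i))) < t → ∃ (Avoids T)
  lineAvoid T a b wa<t wb<t = (inj₂ (a , b) , proj₁ A , proj₁ B) , avoids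
    where
    A = block-avoid (λ i → T (inj₂ (zero , a , i))) wa<t
    B = block-avoid (λ i → ⋁ λ x → T (inj₂ (suc x , line a b (suc x) , i)))
          (≤-<-trans (card-projection λ x i → T (inj₂ (suc x , line a b (suc x) , i))) wb<t)
    on-line : ∀ c i → blockAt c (proj₁ A) (proj₁ B) i ≡ true → T (inj₂ (c , line a b c , i)) ≡ false
    on-line zero    i eq = proj₂ A i eq
    on-line (suc x) i eq = ⋁-false (λ x → T (inj₂ (suc x , line a b (suc x) , i))) (proj₂ B i eq) x
    avoids : Avoids T (inj₂ (a , b) , proj₁ A , proj₁ B)
    avoids (inj₂ (c , v , i)) eq = trans (cong (λ z → T (inj₂ (c , z , i))) (==⇒≡ {i = v} (proj₁ (∧-true eq))))
      (on-line c i (proj₂ (∧-true {v == line a b c} eq)))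

  -- If the common point is light, it is the point u, and the q + 1 columns are averaged. If it is
  -- heavy, it uses up `t` vertices of `T`; the fewer than `t * q` that remain are what `light-line`
  -- asks for, and u lies in column 0.
  planeAvoid : ∀ T → card planeShape T < suc q * t → ∃ (Avoids T)
  planeAvoid T T< = [ light-centre , heavy-centre ]′ (<-≤-connex (card (fin m) (T ∘ inj₁)) t)
    where
    light-centre : card (fin m) (T ∘ inj₁) < t → ∃ (Avoids T)
    light-centre T₁<t =
      let c , Tc<t = averaging (fin (suc q)) t (λ c → card (fin q ⊗ fin m) λ y → T (inj₂ (c , y)))
            (<-≤-trans (≤-<-trans (m≤n+m _ (card (fin m) (T ∘ inj₁))) T<) (≤-reflexive (*-comm (suc q) t)))
      in columnAvoid T c T₁<t Tc<t
    heavy-centre : t ≤ card (fin m) (T ∘ inj₁) → ∃ (Avoids T)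
    heavy-centre t≤T₁ =
      let a , b , wa<t , wb<t = light-line t (λ c v → card (fin m) λ i → T (inj₂ (c , v , i)))
            (<-≤-trans (+-cancelˡ-< t _ _ (≤-<-trans (+-monoˡ-≤ _ t≤T₁) T<)) (≤-reflexive (*-comm q t)))
      in lineAvoid T a b wa<t wb<t

  planeSystem : System planeShape (suc q * t) ((suc q + q * q) * (2 ^ m * 2 ^ m))
  planeSystem = record
    { Index   = PlaneIndex
    ; listing = list-× (list-⊎ (list-Fin (suc q)) (list-× (list-Fin q) (list-Fin q))) (list-× list-blocks list-blocks)
    ; edge    = planeEdge
    ; uniform = planeUniform
    ; meet    = planeMeet
    ; avoid   = planeAvoid
    }

-- Raising the uniformity by adding rows

eqᵇ : ∀ s → El s → El s → Bool
eqᵇ (fin n) i j = i == j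
eqᵇ (s ⊕ u) (inj₁ x) (inj₁ y) = eqᵇ s x y
eqᵇ (s ⊕ u) (inj₁ _) (inj₂ _) = false
eqᵇ (s ⊕ u) (inj₂ _) (inj₁ _) = false
eqᵇ (s ⊕ u) (inj₂ x) (inj₂ y) = eqᵇ u x y
eqᵇ (s ⊗ u) (x , y) (x′ , y′) = eqᵇ s x x′ ∧ eqᵇ u y y′

eqᵇ-refl : ∀ s x → eqᵇ s x x ≡ true
eqᵇ-refl (fin n) i = ==-refl i
eqᵇ-refl (s ⊕ u) (inj₁ x) = eqᵇ-refl s x
eqᵇ-refl (s ⊕ u) (inj₂ y) = eqᵇ-refl u y
eqᵇ-refl (s ⊗ u) (x , y) = cong₂ _∧_ (eqᵇ-refl s x) (eqᵇ-refl u y)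

eqᵇ⇒≡ : ∀ s x y → eqᵇ s x y ≡ true → x ≡ y
eqᵇ⇒≡ (fin n) i j eq = ==⇒≡ eq
eqᵇ⇒≡ (s ⊕ u) (inj₁ x) (inj₁ y) eq = cong inj₁ (eqᵇ⇒≡ s x y eq)
eqᵇ⇒≡ (s ⊕ u) (inj₂ x) (inj₂ y) eq = cong inj₂ (eqᵇ⇒≡ u x y eq)
eqᵇ⇒≡ (s ⊗ u) (x , y) (x′ , y′) eq = let p , p′ = ∧-true eq in cong₂ _,_ (eqᵇ⇒≡ s x x′ p) (eqᵇ⇒≡ u y y′ p′)

card-singleton : ∀ s y → card s (λ x → eqᵇ s x y) ≡ 1
card-singleton (fin n) j = trans (∑-cong (fin n) λ i → bool (i == j)) (∑-fibre j (λ _ → 1))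
  where
  bool : ∀ b → [ b ] ≡ (if b then 1 else 0)
  bool true  = refl
  bool false = refl
card-singleton (s ⊕ u) (inj₁ y) = cong₂ _+_ (card-singleton s y) (trans (∑-const u 0) (*-zeroʳ (size u)))
card-singleton (s ⊕ u) (inj₂ y) = cong₂ _+_ (trans (∑-const s 0) (*-zeroʳ (size s))) (card-singleton u y)
card-singleton (s ⊗ u) (x′ , y′) = trans (∑-cong s λ x → trans (∑-cong u λ y → [∧] (eqᵇ s x x′) (eqᵇ u y y′))
    (trans (∑-if u (eqᵇ s x x′) λ y → [ eqᵇ u y y′ ]) (trans (cong (λ z → if eqᵇ s x x′ then z else 0) (card-singleton u y′)) (bool (eqᵇ s x x′)))))
  (card-singleton s x′)
  where
  bool : ∀ b → (if b then 1 else 0) ≡ [ b ]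
  bool true  = refl
  bool false = refl

-- The reason for three groups of rows: each of two transversals may give up its line on one group.
third : ∀ (h h′ : Fin 3) → ∃ λ i → (i == h) ≡ false × (i == h′) ≡ false
third zero             zero             = suc zero , refl , refl
third zero             (suc zero)       = suc (suc zero) , refl , refl
third zero             (suc (suc zero)) = suc zero , refl , refl
third (suc zero)       zero             = suc (suc zero) , refl , refl
third (suc zero)       (suc zero)       = zero , refl , refl
third (suc zero)       (suc (suc zero)) = zero , refl , refl
third (suc (suc zero)) zero             = suc zero , refl , refl
third (suc (suc zero)) (suc zero)       = zero , refl , refl
third (suc (suc zero)) (suc (suc zero)) = zero , refl , refl

-- Two groups of weight `q` or more would already hold `2 * q` vertices; hence the requirement
-- `d ≤ 2 * q`.
one-heavy : ∀ q (W : Fin 3 → ℕ) → sum W < 2 * q → ∃ λ h → ∀ i → (i == h) ≡ false → W i < q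
one-heavy q W W< with W zero <? q | W (suc zero) <? q
... | yes W₀< | yes W₁< = suc (suc zero) , λ { zero _ → W₀< ; (suc zero) _ → W₁< ; (suc (suc zero)) () }
... | yes W₀< | no  W₁≮ = suc zero , λ { zero _ → W₀< ; (suc zero) () ; (suc (suc zero)) _ → light }
  where
  light : W (suc (suc zero)) < q
  light = +-cancelˡ-< q _ _ (begin-strict
    q + W (suc (suc zero))                      ≤⟨ +-mono-≤ (≮⇒≥ W₁≮) (m≤m+n _ 0) ⟩
    W (suc zero) + (W (suc (suc zero)) + 0)     ≤⟨ m≤n+m _ (W zero) ⟩
    sum W                                       <⟨ W< ⟩
    q + (q + 0)                                 ≡⟨ cong (q +_) (+-identityʳ q) ⟩
    q + q                                       ∎)
    where open ≤-Reasoning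
... | no W₀≮ | _ = zero , λ { zero () ; (suc zero) _ → light (m≤m+n _ _) ; (suc (suc zero)) _ → light (≤-trans (m≤m+n _ 0) (m≤n+m _ (W (suc zero)))) }
  where
  light : ∀ {w} → w ≤ W (suc zero) + (W (suc (suc zero)) + 0) → w < q
  light {w} w≤ = +-cancelˡ-< q _ _ (begin-strict
    q + w           ≤⟨ +-mono-≤ (≮⇒≥ W₀≮) w≤ ⟩
    sum W           <⟨ W< ⟩
    q + (q + 0)     ≡⟨ cong (q +_) (+-identityʳ q) ⟩
    q + q           ∎)
    where open ≤-Reasoning

[b]<1⇒false : ∀ b → [ b ] < 1 → b ≡ false
[b]<1⇒false false _ = refl
[b]<1⇒false true (s≤s ())

-- Two transversals meet because on one of the three groups of q + 1 rows both are lines.  A set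
-- of fewer than d vertices of the rows leaves some column free and has q or more elements in
-- at most one of the groups; so it misses a transversal which follows lines on the other
-- two groups and the free column elsewhere.
module Extend (q : ℕ) (q-prime : Prime q) (d ρ : ℕ) (q≤d : q ≤ d) (d≤2q : d ≤ 2 * q)
              {s : Shape} {r′ M : ℕ} (S : System s r′ M)
              (r′+d≡ : r′ + d ≡ 3 * suc q + ρ) where
  open Lines q q-prime

  Rows : Shape
  Rows = (fin 3 ⊗ fin (suc q)) ⊕ fin ρ

  extendedShape : Shape
  extendedShape = s ⊕ Rows ⊗ fin d

  Transversal : Set
  Transversal = (Fin 3 × Fin d) × Vec (Fin q × Fin q) 3

  -- Lines use the first `q` of the `d` columns, whence the requirement `q ≤ d`.
  lineAt : Vec (Fin q × Fin q) 3 → Fin 3 → Fin (suc q) → Fin d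
  lineAt ls i c = inject≤ (line (proj₁ (lookup ls i)) (proj₂ (lookup ls i)) c) q≤d

  -- The column `a₀` replaces the line on group `h`, where no line avoiding `T` may exist. It also
  -- fills the `ρ` rows outside the groups, which bring the size of a transversal up to `r′ + d`.
  value : Transversal → El Rows → Fin d
  value ((h , a₀) , ls) (inj₁ (i , c)) = if i == h then a₀ else lineAt ls i c
  value ((h , a₀) , ls) (inj₂ _)       = a₀

  extendedEdge : (Index S × El Rows) ⊎ Transversal → El extendedShape → Bool
  extendedEdge (inj₁ (e , _))   (inj₁ v)         = edge S e v
  extendedEdge (inj₁ (_ , row)) (inj₂ (row′ , a)) = eqᵇ Rows row′ row
  extendedEdge (inj₂ g)         (inj₁ v)         = false
  extendedEdge (inj₂ g)         (inj₂ (row , a)) = a == value g row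

  extendedUniform : ∀ e → card extendedShape (extendedEdge e) ≡ r′ + d
  extendedUniform (inj₁ (e , row)) = cong₂ _+_ (uniform S e) (begin
    ∑ Rows (λ row′ → sum {d} λ _ → [ eqᵇ Rows row′ row ])   ≡⟨ ∑-swap Rows (fin d) (λ row′ _ → [ eqᵇ Rows row′ row ]) ⟩
    sum {d} (λ _ → ∑ Rows λ row′ → [ eqᵇ Rows row′ row ])   ≡⟨ ∑-const (fin d) _ ⟩
    d * card Rows (λ row′ → eqᵇ Rows row′ row)              ≡⟨ cong (d *_) (card-singleton Rows row) ⟩
    d * 1                                                   ≡⟨ *-identityʳ d ⟩
    d ∎)
    where open ≡-Reasoning
  extendedUniform (inj₂ g) = begin
    ∑ s (λ _ → 0) + ∑ Rows (λ row → card (fin d) (_== value g row)) ≡⟨ cong₂ _+_ (trans (∑-const s 0) (*-zeroʳ (size s))) (∑-cong Rows λ row → card-singleton (fin d) (value g row)) ⟩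
    ∑ Rows (λ _ → 1)   ≡⟨ ∑-const Rows 1 ⟩
    size Rows * 1      ≡⟨ *-identityʳ (size Rows) ⟩
    3 * suc q + ρ      ≡⟨ r′+d≡ ⟨
    r′ + d             ∎
    where open ≡-Reasoning

  value-line : ∀ h a₀ ls i c → (i == h) ≡ false → value ((h , a₀) , ls) (inj₁ (i , c)) ≡ lineAt ls i c
  value-line h a₀ ls i c i≢h rewrite i≢h = refl

  extendedMeet : ∀ e e′ → ∃ λ v → extendedEdge e v ≡ true × extendedEdge e′ v ≡ true
  extendedMeet (inj₁ (e , _)) (inj₁ (e′ , _)) = let v , x , y = meet S e e′ in inj₁ v , x , y
  extendedMeet (inj₁ (_ , row)) (inj₂ g) = inj₂ (row , value g row) , eqᵇ-refl Rows row , ==-refl (value g row)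
  extendedMeet (inj₂ g) (inj₁ (_ , row)) = inj₂ (row , value g row) , ==-refl (value g row) , eqᵇ-refl Rows row
  extendedMeet (inj₂ g@((h , a₀) , ls)) (inj₂ g′@((h′ , a₀′) , ls′))
    with i , i≢h , i≢h′ ← third h h′
    with c , eq ← lines-meet (proj₁ (lookup ls i)) (proj₂ (lookup ls i)) (proj₁ (lookup ls′ i)) (proj₂ (lookup ls′ i))
    = inj₂ (row , value g row) , ==-refl (value g row) , trans (cong (value g row ==_) (sym agree)) (==-refl (value g row))
    where
    row = inj₁ (i , c)
    agree : value g row ≡ value g′ row
    agree = trans (value-line h a₀ ls i c i≢h)
      (trans (cong (λ v → inject≤ v q≤d) eq) (sym (value-line h′ a₀′ ls′ i c i≢h′)))

  -- This is `light-line` for `t = 1`: weight below 1 means that no point of the line lies in `T`.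
  lightLine : (T : Fin (suc q) → Fin d → Bool) → sum (λ c → card (fin d) (T c)) < q →
              Σ (Fin q × Fin q) λ (a , b) → ∀ c → T c (inject≤ (line a b c) q≤d) ≡ false
  lightLine T T<q =
    let a , b , wa<1 , wb<1 = light-line 1 (λ c v → [ T c (inject≤ v q≤d) ]) (<-≤-trans (≤-<-trans
          (∑-mono (fin (suc q)) λ c → sum-injective (λ v → inject≤ v q≤d)
            (λ {v} {v′} → inject≤-injective q≤d q≤d v v′) ([_] ∘ T c)) T<q)
          (≤-reflexive (sym (*-identityˡ q))))
    in (a , b) , λ { zero    → [b]<1⇒false _ wa<1
                   ; (suc x) → card<1⇒empty (fin q) (λ x → T (suc x) (inject≤ (line a b (suc x)) q≤d)) wb<1 x }

  mkTransversal : ∀ (T : El Rows → Fin d → Bool) h a₀ → (∀ row → T row a₀ ≡ false) →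
    (∀ i → (i == h) ≡ false → sum (λ c → card (fin d) (T (inj₁ (i , c)))) < q) →
    ∃ λ g → ∀ row → T row (value g row) ≡ false
  mkTransversal T h a₀ free light = ((h , a₀) , ls) , avoids
    where
    Good : Fin 3 → Fin q × Fin q → Set
    Good i (a , b) = ∀ c → T (inj₁ (i , c)) (inject≤ (line a b c) q≤d) ≡ false
    choose : ∀ i b → (i == h) ≡ b → Σ (Fin q × Fin q) λ ab → b ≡ false → Good i ab
    -- On group `h` the column `a₀` is used, so any pair will do as a line.
    choose i true  _   = (mod 0 , mod 0) , λ ()
    choose i false i≢h = let ab , good = lightLine (λ c → T (inj₁ (i , c))) (light i i≢h) in ab , λ _ → good
    pick : Fin 3 → Fin q × Fin q
    pick i = proj₁ (choose i (i == h) refl)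
    ls = tabulate pick
    on-line : ∀ i → (i == h) ≡ false → Good i (lookup ls i)
    on-line i i≢h = subst (Good i) (sym (lookup∘tabulate pick i)) (proj₂ (choose i (i == h) refl) i≢h)
    on-group : ∀ i c b → (i == h) ≡ b → T (inj₁ (i , c)) (if b then a₀ else lineAt ls i c) ≡ false
    on-group i c true  _   = free (inj₁ (i , c))
    on-group i c false i≢h = on-line i i≢h c
    avoids : ∀ row → T row (value ((h , a₀) , ls) row) ≡ false
    avoids (inj₂ k)       = free (inj₂ k)
    avoids (inj₁ (i , c)) = on-group i c (i == h) refl

  transversalAvoid : ∀ (T : El Rows → Fin d → Bool) → ∑ Rows (λ row → card (fin d) (T row)) < d →
                     ∃ λ g → ∀ row → T row (value g row) ≡ false
  transversalAvoid T T<d =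
    let a₀ , free  = averaging (fin d) 1 (λ a → card Rows λ row → T row a)
                       (subst₂ _<_ (∑-swap Rows (fin d) (λ row a → [ T row a ])) (sym (*-identityˡ d)) T<d)
        h  , light = one-heavy q (λ i → sum λ c → card (fin d) (T (inj₁ (i , c))))
                       (≤-<-trans (m≤m+n _ _) (<-≤-trans T<d d≤2q))
    in mkTransversal T h a₀ (card<1⇒empty Rows (λ row → T row a₀) free) light

  -- With fewer than `r′` vertices in `s`, an old edge is missed; there are `r′ + d` rows, more than
  -- `T` has vertices, so some row is missed too. Otherwise fewer than `d` vertices are left for the
  -- rows, and a transversal is missed.
  extendedAvoid : ∀ T → card extendedShape T < r′ + d → ∃ λ e → ∀ v → extendedEdge e v ≡ true → T v ≡ false
  extendedAvoid T T< = [ light , heavy ]′ (<-≤-connex (card s (T ∘ inj₁)) r′)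
    where
    light : card s (T ∘ inj₁) < r′ → ∃ λ e → ∀ v → extendedEdge e v ≡ true → T v ≡ false
    light T₁<r′ =
      let e , e-avoids = avoid S (T ∘ inj₁) T₁<r′
          row , free   = averaging Rows 1 (λ row → card (fin d) λ a → T (inj₂ (row , a)))
            (<-≤-trans (≤-<-trans (m≤n+m _ (card s (T ∘ inj₁))) T<) (≤-reflexive (trans r′+d≡ (sym (*-identityˡ (size Rows))))))
      in inj₁ (e , row) , λ
        { (inj₁ v) eq → e-avoids v eq
        ; (inj₂ (row′ , a)) eq → trans (cong (λ z → T (inj₂ (z , a))) (eqᵇ⇒≡ Rows row′ row eq))
                                       (card<1⇒empty (fin d) (λ a → T (inj₂ (row , a))) free a) }
    heavy : r′ ≤ card s (T ∘ inj₁) → ∃ λ e → ∀ v → extendedEdge e v ≡ true → T v ≡ false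
    heavy r′≤T₁ =
      let g , g-avoids = transversalAvoid (λ row a → T (inj₂ (row , a)))
                           (+-cancelˡ-< r′ _ _ (≤-<-trans (+-monoˡ-≤ _ r′≤T₁) T<))
      in inj₂ g , λ { (inj₂ (row , a)) eq → trans (cong (λ z → T (inj₂ (row , z))) (==⇒≡ {i = a} eq)) (g-avoids row) }

  extendedSystem : System extendedShape (r′ + d) (M * size Rows + 3 * d * (q * q) ^ 3)
  extendedSystem = record
    { Index   = (Index S × El Rows) ⊎ Transversal
    ; listing = list-⊎ (list-× (listing S) (list-El Rows))
                       (list-× (list-× (list-Fin 3) (list-Fin d)) (list-Vec (list-× (list-Fin q) (list-Fin q)) 3))
    ; edge    = extendedEdge
    ; uniform = extendedUniform
    ; meet    = extendedMeet
    ; avoid   = extendedAvoid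
    }

-- From systems to hypergraphs

_≟ˢ_ : ∀ {n} → DecidableEquality (Subset n)
_≟ˢ_ = ≡-dec _≟ᵇ_

∣p∣≡card : ∀ {n} (p : Subset n) → ∣ p ∣ ≡ card (fin n) (lookup p)
∣p∣≡card []            = refl
∣p∣≡card (inside ∷ p)  = cong suc (∣p∣≡card p)
∣p∣≡card (outside ∷ p) = ∣p∣≡card p

-- Isolated vertices change nothing, so a system need only fit into `n` vertices.
pad : ∀ {s r M} k → System s r M → System (s ⊕ fin k) r M
pad {s} k S = record
  { Index   = Index S
  ; listing = listing S
  ; edge    = edge′
  ; uniform = λ i → trans (cong₂ _+_ (uniform S i) (trans (∑-const (fin k) 0) (*-zeroʳ k))) (+-identityʳ _)
  ; meet    = λ i j → let v , x , y = meet S i j in inj₁ v , x , y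
  ; avoid   = λ T T< → let i , i-avoids = avoid S (T ∘ inj₁) (≤-<-trans (m≤m+n _ _) T<)
                       in i , λ { (inj₁ v) eq → i-avoids v eq }
  }
  where
  edge′ : Index S → El (s ⊕ fin k) → Bool
  edge′ i (inj₁ v) = edge S i v
  edge′ i (inj₂ _) = false

module _ {s : Shape} {r M : ℕ} (S : System s r M) (0<r : 0 < r) where

  private
    subset : Index S → Subset (size s)
    subset i = tabulate (edge S i ∘ fromFin s)

    subsets : List (Subset (size s))
    subsets = map subset (items (listing S))

    system-edges : List (Subset (size s))
    system-edges = deduplicate _≟ˢ_ subsets

    index : ∀ {e} → e ∈ system-edges → ∃ λ i → e ≡ subset i
    index e∈ = let i , _ , e≡ = ∈-map⁻ subset (∈-deduplicate⁻ _≟ˢ_ subsets e∈) in i , e≡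

    subset∈ : ∀ i → subset i ∈ system-edges
    subset∈ i = ∈-deduplicate⁺ _≟ˢ_ (∈-map⁺ subset (complete (listing S) i))

    lookup-subset : ∀ i x → lookup (subset i) (toFin s x) ≡ edge S i x
    lookup-subset i x = trans (lookup∘tabulate _ (toFin s x)) (cong (edge S i) (from-to s x))

    ∣subset∣ : ∀ i → ∣ subset i ∣ ≡ r
    ∣subset∣ i = trans (∣p∣≡card (subset i)) (trans
      (∑-cong (fin (size s)) λ v → cong [_] (lookup∘tabulate (edge S i ∘ fromFin s) v))
      (trans (∑-fromFin s ([_] ∘ edge S i)) (uniform S i)))

    subset-meet : ∀ i j → Nonempty (subset i ∩ subset j)
    subset-meet i j = let x , ex , ey = meet S i j in toFin s x , x∈p∩q⁺
      ( lookup⇒[]= (toFin s x) (subset i) (trans (lookup-subset i x) ex)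
      , lookup⇒[]= (toFin s x) (subset j) (trans (lookup-subset j x) ey))

    -- The empty set has fewer than `r` elements and so misses an edge. As all edges meet, this edge
    -- serves as a cover of size `r`.
    some-index : Index S
    some-index = proj₁ (avoid S (λ _ → false) (≤-<-trans (≤-reflexive (trans (∑-const s 0) (*-zeroʳ (size s)))) 0<r))

  systemHypergraph : Hypergraph (size s)
  systemHypergraph = record { edges = system-edges ; unique = deduplicate-! _≟ˢ_ subsets }

  system-numEdges : numEdges systemHypergraph ≤ M
  system-numEdges = ≤-trans (length-deduplicate _≟ˢ_ subsets)
    (≤-reflexive (trans (length-map subset (items (listing S))) (length≡ (listing S))))

  private
    meets-all : ∀ i → IsCover systemHypergraph (subset i)
    meets-all i e e∈ = let j , e≡ = index e∈ in subst (λ z → Nonempty (z ∩ subset i)) (sym e≡) (subset-meet j i)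

    cover-large : ∀ T → IsCover systemHypergraph T → r ≤ ∣ T ∣
    cover-large T covers = ≮⇒≥ λ T<r →
      let i , i-avoids = avoid S (λ x → lookup T (toFin s x)) (subst (_< r)
            (trans (∣p∣≡card T) (sym (∑-toFin s ([_] ∘ lookup T)))) T<r)
          v , v∈ = covers (subset i) (subset∈ i)
          v∈i , v∈T = x∈p∩q⁻ (subset i) T v∈
          on-edge = trans (sym (lookup∘tabulate (edge S i ∘ fromFin s) v)) ([]=⇒lookup v∈i)
      in absurd (trans (sym (i-avoids (fromFin s v) on-edge))
           (trans (cong (lookup T) (to-from s v)) ([]=⇒lookup v∈T)))
      where
      absurd : ∀ {A : Set} → false ≡ true → A
      absurd ()

  system-admissible : Admissible (size s) r systemHypergraph
  system-admissible =
      (λ e e∈ → let i , e≡ = index e∈ in trans (cong ∣_∣ e≡) (∣subset∣ i))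
    , (λ e e′ e∈ e′∈ → let i , e≡ = index e∈ ; j , e′≡ = index e′∈ in
         subst₂ (λ x y → Nonempty (x ∩ y)) (sym e≡) (sym e′≡) (subset-meet i j))
    , (subset some-index , meets-all some-index , ∣subset∣ some-index)
    , cover-large

system⇒hypergraph : ∀ {s r M n} → System s r M → 0 < r → size s ≤ n →
                    Σ (Hypergraph n) λ H → Admissible n r H × numEdges H ≤ M
system⇒hypergraph {s} {r} {M} {n} S 0<r s≤n =
  subst (λ n → Σ (Hypergraph n) λ H → Admissible n r H × numEdges H ≤ M) (m+[n∸m]≡n s≤n)
    (systemHypergraph S′ 0<r , system-admissible S′ 0<r , system-numEdges S′ 0<r)
  where S′ = pad (n ∸ size s) S

-- The minimum exists

∀∈? : ∀ {A : Set} {P : A → Set} → Decidable P → ∀ xs → Dec (∀ x → x ∈ xs → P x)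
∀∈? P? xs = map′ (λ ps x x∈ → All.lookup ps x∈) (λ f → All.tabulate λ {x} → f x) (all? P? xs)

isCover? : ∀ {n} (H : Hypergraph n) → Decidable (IsCover H)
isCover? H T = ∀∈? (λ e → nonempty? (e ∩ T)) (edges H)

admissible? : ∀ {n} r (H : Hypergraph n) → Dec (Admissible n r H)
admissible? r H = ∀∈? (λ e → ∣ e ∣ ≟ r) (edges H)
  ×-dec map′ (λ f e₁ e₂ e₁∈ e₂∈ → f e₁ e₁∈ e₂ e₂∈) (λ f e₁ e₁∈ e₂ → f e₁ e₂ e₁∈)
          (∀∈? (λ e₁ → ∀∈? (λ e₂ → nonempty? (e₁ ∩ e₂)) (edges H)) (edges H))
  ×-dec anySubset? (λ T → isCover? H T ×-dec (∣ T ∣ ≟ r))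
  ×-dec no-small-cover
  where
  no-small-cover : Dec (∀ T → IsCover H T → r ≤ ∣ T ∣)
  no-small-cover with anySubset? (λ T → isCover? H T ×-dec (∣ T ∣ <? r))
  ... | yes (T , covers , T<r) = no λ large → <⇒≱ T<r (large T covers)
  ... | no none = yes λ T covers → ≮⇒≥ λ T<r → none (T , covers , T<r)

HasAdmissible : ℕ → ℕ → ℕ → Set
HasAdmissible n r m = Σ (Hypergraph n) λ H → Admissible n r H × numEdges H ≡ m

-- For a fixed number of edges only finitely many edge lists are possible. Decidability is what
-- makes the least `m`, hence f(n, r), available constructively.
hasAdmissible? : ∀ n r m → Dec (HasAdmissible n r m)
hasAdmissible? n r m = map′ to from (any? good? (items candidates))
  where
  candidates : Listing (Vec (Subset n) m) ((2 ^ n) ^ m)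
  candidates = list-Vec (list-Vec list-Bool n) m
  Good : List (Subset n) → Set
  Good es = Σ (Unique es) λ u → Admissible n r (record { edges = es ; unique = u })
  good? : ∀ v → Dec (Good (toList v))
  good? v with unique? _≟ˢ_ (toList v)
  ... | no ¬u = no λ (u , _) → ¬u u
  ... | yes u = map′ (u ,_) proj₂ (admissible? r (record { edges = toList v ; unique = u }))
  to : Any (Good ∘ toList) (items candidates) → HasAdmissible n r m
  to found = let v , u , adm = satisfied found in record { edges = toList v ; unique = u } , adm , length-toList v
  from : HasAdmissible n r m → Any (Good ∘ toList) (items candidates)
  from (H , adm , refl) = lose (complete candidates (fromList (edges H)))
    (subst Good (sym (toList∘fromList (edges H))) (unique H , adm))

least : ∀ {P : ℕ → Set} → Decidable P → ∀ n → P n → ∃ λ m → m ≤ n × P m × (∀ k → P k → m ≤ k)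
least {P} P? = <-rec _ λ n rec pn → step n (λ {k} → rec {k}) pn
  where
  step : ∀ n → (∀ {k} → k < n → P k → ∃ λ m → m ≤ k × P m × (∀ j → P j → m ≤ j)) →
         P n → ∃ λ m → m ≤ n × P m × (∀ k → P k → m ≤ k)
  step n rec pn with anyUpTo? P? n
  ... | no none = n , ≤-refl , pn , λ k pk → ≮⇒≥ λ k<n → none (k , k<n , pk)
  ... | yes (k , k<n , pk) = let m , m≤k , rest = rec k<n pk in m , ≤-trans m≤k (<⇒≤ k<n) , rest

minimum : ∀ {n r} (H : Hypergraph n) → Admissible n r H → ∃ λ m → m ≤ numEdges H × IsF n r m
minimum {n} {r} H adm =
  let m , m≤ , found , minimal = least (hasAdmissible? n r) (numEdges H) (H , adm , refl)
  in m , m≤ , found , λ H′ adm′ → minimal (numEdges H′) (H′ , adm′ , refl)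

-- The lower bound

∑-*ˡ : ∀ c {n} (f : Fin n → ℕ) → sum (λ i → c * f i) ≡ c * sum f
∑-*ˡ c {zero}  f = sym (*-zeroʳ c)
∑-*ˡ c {suc n} f = trans (cong (c * f zero +_) (∑-*ˡ c (f ∘ suc))) (sym (*-distribˡ-+ c (f zero) _))

missing : ∀ {n} → Fin n → List (Subset n) → List (Subset n)
missing i = filter (λ e → lookup e i ≟ᵇ false)

length-missing-∷ : ∀ {n} (i : Fin n) e es → length (missing i (e ∷ es)) ≡ [ not (lookup e i) ] + length (missing i es)
length-missing-∷ i e es with lookup e i
... | true  = refl
... | false = refl

-- Double counting: every edge is missed by exactly `n ∸ r` vertices.
∑-missing : ∀ {n r} (es : List (Subset n)) → (∀ e → e ∈ es → ∣ e ∣ ≡ r) →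
            sum (λ i → length (missing i es)) ≡ length es * (n ∸ r)
∑-missing {n} [] _ = trans (∑-const (fin n) 0) (*-zeroʳ n)
∑-missing {n} {r} (e ∷ es) uni = begin
  sum (λ i → length (missing i (e ∷ es)))                           ≡⟨ ∑-cong (fin n) (λ i → length-missing-∷ i e es) ⟩
  sum (λ i → [ not (lookup e i) ] + length (missing i es))          ≡⟨ ∑-+ (fin n) _ _ ⟩
  card (fin n) (not ∘ lookup e) + sum (λ i → length (missing i es)) ≡⟨ cong₂ _+_ complement (∑-missing es λ e′ → uni e′ ∘ there) ⟩
  n ∸ r + length es * (n ∸ r)                                       ∎
  where
  open ≡-Reasoning
  complement : card (fin n) (not ∘ lookup e) ≡ n ∸ r
  complement = begin
    card (fin n) (not ∘ lookup e)                                              ≡⟨ m+n∸m≡n (card (fin n) (lookup e)) _ ⟨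
    (card (fin n) (lookup e) + card (fin n) (not ∘ lookup e)) ∸ card (fin n) (lookup e) ≡⟨ cong₂ _∸_ (card-not (fin n) (lookup e)) (trans (sym (∣p∣≡card e)) (uni e (here refl))) ⟩
    n ∸ r ∎

popular-vertex : ∀ {n r} → 0 < n → (es : List (Subset n)) → (∀ e → e ∈ es → ∣ e ∣ ≡ r) →
                 ∃ λ i → n * length (missing i es) ≤ length es * (n ∸ r)
popular-vertex {n} {r} 0<n es uni =
  -- `averaging` yields a strict inequality, so the threshold is one above the intended bound.
  let i , i< = averaging (fin n) (suc (length es * (n ∸ r))) (λ i → n * length (missing i es)) (begin-strict
        sum (λ i → n * length (missing i es))  ≡⟨ ∑-*ˡ n (λ i → length (missing i es)) ⟩
        n * sum (λ i → length (missing i es))  ≡⟨ cong (n *_) (∑-missing es uni) ⟩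
        n * (length es * (n ∸ r))              ≡⟨ *-comm n _ ⟩
        length es * (n ∸ r) * n                <⟨ *-monoˡ-< n {{>-nonZero 0<n}} (n<1+n (length es * (n ∸ r))) ⟩
        suc (length es * (n ∸ r)) * n          ∎)
  in i , s≤s⁻¹ i<
  where open ≤-Reasoning

∣p∪q∣≤ : ∀ {n} (p q : Subset n) → ∣ p ∪ q ∣ ≤ ∣ p ∣ + ∣ q ∣
∣p∪q∣≤ []            []            = z≤n
∣p∪q∣≤ (inside ∷ p)  (inside ∷ q)  = s≤s (≤-trans (∣p∪q∣≤ p q) (+-monoʳ-≤ ∣ p ∣ (n≤1+n _)))
∣p∪q∣≤ (inside ∷ p)  (outside ∷ q) = s≤s (∣p∪q∣≤ p q)
∣p∪q∣≤ (outside ∷ p) (inside ∷ q)  = ≤-trans (s≤s (∣p∪q∣≤ p q)) (≤-reflexive (sym (+-suc ∣ p ∣ ∣ q ∣)))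
∣p∪q∣≤ (outside ∷ p) (outside ∷ q) = ∣p∪q∣≤ p q

-- `rest` contains the edges that the chosen vertices miss. Its share of at most (1 - r/n)^k is
-- stated with the denominators cleared.
greedy-cover : ∀ {n r} → 0 < n → ∀ k (es : List (Subset n)) → (∀ e → e ∈ es → ∣ e ∣ ≡ r) →
  ∃₂ λ T rest → ∣ T ∣ ≤ k × (∀ e → e ∈ es → Nonempty (e ∩ T) ⊎ e ∈ rest) × length rest * n ^ k ≤ length es * (n ∸ r) ^ k
greedy-cover {n} 0<n zero es _ = ∅ , es , ≤-reflexive (∣⊥∣≡0 n) , (λ e → inj₂) , ≤-refl
greedy-cover {n} {r} 0<n (suc k) es uni =
  let i , popular = popular-vertex 0<n es uni
      T , rest , T≤k , hit , few = greedy-cover 0<n k (missing i es) (λ e e∈ → uni e (proj₁ (∈-filter⁻ (missed i) {xs = es} e∈)))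
  in ⁅ i ⁆ ∪ T , rest
   , ≤-trans (∣p∪q∣≤ ⁅ i ⁆ T) (+-mono-≤ (≤-reflexive (∣⁅x⁆∣≡1 i)) T≤k)
   , (λ e e∈ → hits i T rest hit e e∈)
   , count (length rest) (length (missing i es)) (length es) few popular
  where
  missed : ∀ i (e : Subset n) → Dec (lookup e i ≡ false)
  missed i e = lookup e i ≟ᵇ false
  hits : ∀ i T rest → (∀ e → e ∈ missing i es → Nonempty (e ∩ T) ⊎ e ∈ rest) →
         ∀ e → e ∈ es → Nonempty (e ∩ (⁅ i ⁆ ∪ T)) ⊎ e ∈ rest
  hits i T rest hit e e∈ with lookup e i in eq
  ... | true  = inj₁ (i , x∈p∩q⁺ (lookup⇒[]= i e eq , p⊆p∪q T (x∈⁅x⁆ i)))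
  ... | false with hit e (∈-filter⁺ (missed i) e∈ eq)
  ...   | inj₂ e∈rest   = inj₂ e∈rest
  ...   | inj₁ (v , v∈) = let v∈e , v∈T = x∈p∩q⁻ e T v∈ in inj₁ (v , x∈p∩q⁺ (v∈e , q⊆p∪q ⁅ i ⁆ T v∈T))
  open ≤-Reasoning
  count : ∀ R m E → R * n ^ k ≤ m * (n ∸ r) ^ k → n * m ≤ E * (n ∸ r) → R * n ^ suc k ≤ E * (n ∸ r) ^ suc k
  count R m E few popular = begin
    R * (n * n ^ k)            ≡⟨ a1 R n (n ^ k) ⟩
    n * (R * n ^ k)            ≤⟨ *-monoʳ-≤ n few ⟩
    n * (m * (n ∸ r) ^ k)      ≡⟨ *-assoc n m _ ⟨
    n * m * (n ∸ r) ^ k        ≤⟨ *-monoˡ-≤ ((n ∸ r) ^ k) popular ⟩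
    E * (n ∸ r) * (n ∸ r) ^ k  ≡⟨ *-assoc E (n ∸ r) _ ⟩
    E * (n ∸ r) ^ suc k        ∎
    where
    a1 : ∀ R n N → R * (n * N) ≡ n * (R * N)
    a1 = solve-∀

greedy-bound : ∀ {n j} (H : Hypergraph n) → 0 < n → Admissible n (suc j) H → n ^ j ≤ numEdges H * (n ∸ suc j) ^ j
greedy-bound {n} {j} H 0<n (uni , _ , _ , large) =
  let T , rest , T≤j , hit , few = greedy-cover 0<n j (edges H) uni in conclude T rest T≤j hit few
  where
  conclude : ∀ T rest → ∣ T ∣ ≤ j → (∀ e → e ∈ edges H → Nonempty (e ∩ T) ⊎ e ∈ rest) →
             length rest * n ^ j ≤ numEdges H * (n ∸ suc j) ^ j → n ^ j ≤ numEdges H * (n ∸ suc j) ^ j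
  conclude T []         T≤j hit few = contradiction (large T λ e e∈ → [ id , (λ ()) ]′ (hit e e∈)) (<⇒≱ (s≤s T≤j))
  conclude T (_ ∷ rest) T≤j hit few = ≤-trans (m≤m+n _ _) few

^-distribʳ-* : ∀ a b k → (a * b) ^ k ≡ a ^ k * b ^ k
^-distribʳ-* a b zero    = refl
^-distribʳ-* a b (suc k) = trans (cong (a * b *_) (^-distribʳ-* a b k)) (swap a b (a ^ k) (b ^ k))
  where
  swap : ∀ a b c d → a * b * (c * d) ≡ a * c * (b * d)
  swap = solve-∀

-- This is (1 + r/n)^k ≥ 1 + kr/n multiplied by n^(k+1).
bernoulli : ∀ n r k → n ^ k * (n + k * r) ≤ n * (n + r) ^ k
bernoulli n r zero    = ≤-reflexive (trans (*-identityˡ (n + 0)) (trans (+-identityʳ n) (sym (*-identityʳ n))))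
bernoulli n r (suc k) = begin
  n * N * (n + (r + k * r))                          ≤⟨ m≤m+n _ _ ⟩
  n * N * (n + (r + k * r)) + N * (r * (k * r))      ≡⟨ a1 n N r k ⟩
  (n + r) * (N * (n + k * r))                        ≤⟨ *-monoʳ-≤ (n + r) (bernoulli n r k) ⟩
  (n + r) * (n * (n + r) ^ k)                        ≡⟨ a2 (n + r) n ((n + r) ^ k) ⟩
  n * (n + r) ^ suc k                                ∎
  where
  open ≤-Reasoning
  N = n ^ k
  a1 : ∀ n N r k → n * N * (n + (r + k * r)) + N * (r * (k * r)) ≡ (n + r) * (N * (n + k * r))
  a1 = solve-∀
  a2 : ∀ a n b → a * (n * b) ≡ n * (a * b)
  a2 = solve-∀

-- Since (1 - r/n)(1 + r/n) ≤ 1, the greedy bound gives (1 + r/n)^j ≤ m. For k = ⌊n/r⌋ + 1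
-- Bernoulli's inequality gives (1 + r/n)^k ≥ 2, so 2^j ≤ m^k. Raising this to the power 2r is
-- enough, as r² ≤ 2rj and 2rk ≤ 4n.
lower-exponent : ∀ n j m → suc j < n → 0 < j → n ^ j ≤ m * (n ∸ suc j) ^ j → 2 ^ (1 * (suc j * suc j)) ≤ m ^ (4 * n)
lower-exponent n j m r<n 0<j bound = begin
  2 ^ (1 * (r * r))     ≤⟨ ^-monoʳ-≤ 2 exponent ⟩
  2 ^ (j * (2 * r))     ≡⟨ ^-*-assoc 2 j (2 * r) ⟨
  (2 ^ j) ^ (2 * r)     ≤⟨ ^-monoˡ-≤ (2 * r) 2^j≤m^k ⟩
  (m ^ k) ^ (2 * r)     ≡⟨ ^-*-assoc m k (2 * r) ⟩
  m ^ (k * (2 * r))     ≤⟨ ^-monoʳ-≤ m 2kr≤4n ⟩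
  m ^ (4 * n)           ∎
  where
  open ≤-Reasoning
  r = suc j
  x = n ∸ r
  k = suc (n / r)
  instance
    n≢0 : NonZero n
    n≢0 = >-nonZero (≤-<-trans z≤n r<n)
    x≢0 : NonZero x
    x≢0 = >-nonZero (m<n⇒0<n∸m r<n)
    xj≢0 : NonZero (x ^ j)
    xj≢0 = m^n≢0 x j
    nj≢0 : NonZero (n ^ j)
    nj≢0 = m^n≢0 n j
    nkj≢0 : NonZero (n ^ (k * j))
    nkj≢0 = m^n≢0 n (k * j)
    m≢0 : NonZero m
    m≢0 = ≢-nonZero λ { refl → contradiction (≤-trans (m^n>0 n j) bound) λ () }
  exponent : 1 * (r * r) ≤ j * (2 * r)
  exponent = begin
    1 * (r * r)   ≡⟨ *-identityˡ (r * r) ⟩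
    (1 + j) * r   ≤⟨ *-monoˡ-≤ r (+-monoˡ-≤ j 0<j) ⟩
    (j + j) * r   ≡⟨ a1 j r ⟩
    j * (2 * r)   ∎
    where
    a1 : ∀ j r → (j + j) * r ≡ j * (2 * r)
    a1 = solve-∀
  n≤kr : n ≤ k * r
  n≤kr = begin
    n                      ≡⟨ m≡m%n+[m/n]*n n r ⟩
    n % r + n / r * r      ≤⟨ +-monoˡ-≤ (n / r * r) (<⇒≤ (m%n<n n r)) ⟩
    k * r                  ∎
  2kr≤4n : k * (2 * r) ≤ 4 * n
  2kr≤4n = begin
    k * (2 * r)            ≡⟨ a1 (n / r) r ⟩
    2 * (r + n / r * r)    ≤⟨ *-monoʳ-≤ 2 (+-mono-≤ (<⇒≤ r<n) (≤-trans (m≤n+m _ (n % r)) (≤-reflexive (sym (m≡m%n+[m/n]*n n r))))) ⟩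
    2 * (n + n)            ≡⟨ a2 n ⟩
    4 * n                  ∎
    where
    a1 : ∀ y r → suc y * (2 * r) ≡ 2 * (r + y * r)
    a1 = solve-∀
    a2 : ∀ n → 2 * (n + n) ≡ 4 * n
    a2 = solve-∀
  n≡r+x : n ≡ r + x
  n≡r+x = sym (m+[n∸m]≡n (<⇒≤ r<n))
  [n+r]x≤n² : (n + r) * x ≤ n * n
  [n+r]x≤n² = begin
    (n + r) * x                ≡⟨ cong (λ n → (n + r) * x) n≡r+x ⟩
    (r + x + r) * x            ≤⟨ m≤m+n _ (r * r) ⟩
    (r + x + r) * x + r * r    ≡⟨ a1 r x ⟩
    (r + x) * (r + x)          ≡⟨ cong₂ _*_ n≡r+x n≡r+x ⟨
    n * n                      ∎
    where
    a1 : ∀ r x → (r + x + r) * x + r * r ≡ (r + x) * (r + x)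
    a1 = solve-∀
  growth : (n + r) ^ j ≤ n ^ j * m
  growth = *-cancelʳ-≤ _ _ (x ^ j) (begin
    (n + r) ^ j * x ^ j        ≡⟨ ^-distribʳ-* (n + r) x j ⟨
    ((n + r) * x) ^ j          ≤⟨ ^-monoˡ-≤ j [n+r]x≤n² ⟩
    (n * n) ^ j                ≡⟨ ^-distribʳ-* n n j ⟩
    n ^ j * n ^ j              ≤⟨ *-monoʳ-≤ (n ^ j) bound ⟩
    n ^ j * (m * x ^ j)        ≡⟨ *-assoc (n ^ j) m _ ⟨
    n ^ j * m * x ^ j          ∎)
  doubling : 2 * n ^ k ≤ (n + r) ^ k
  doubling = *-cancelˡ-≤ n (begin
    n * (2 * n ^ k)            ≡⟨ a1 n (n ^ k) ⟩
    n ^ k * (n + n)            ≤⟨ *-monoʳ-≤ (n ^ k) (+-monoʳ-≤ n n≤kr) ⟩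
    n ^ k * (n + k * r)        ≤⟨ bernoulli n r k ⟩
    n * (n + r) ^ k            ∎)
    where
    a1 : ∀ n N → n * (2 * N) ≡ N * (n + n)
    a1 = solve-∀
  2^j≤m^k : 2 ^ j ≤ m ^ k
  2^j≤m^k = *-cancelʳ-≤ _ _ (n ^ (k * j)) (begin
    2 ^ j * n ^ (k * j)        ≡⟨ cong (2 ^ j *_) (^-*-assoc n k j) ⟨
    2 ^ j * (n ^ k) ^ j        ≡⟨ ^-distribʳ-* 2 (n ^ k) j ⟨
    (2 * n ^ k) ^ j            ≤⟨ ^-monoˡ-≤ j doubling ⟩
    ((n + r) ^ k) ^ j          ≡⟨ trans (^-*-assoc (n + r) k j) (trans (cong ((n + r) ^_) (*-comm k j)) (sym (^-*-assoc (n + r) j k))) ⟩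
    ((n + r) ^ j) ^ k          ≤⟨ ^-monoˡ-≤ k growth ⟩
    (n ^ j * m) ^ k            ≡⟨ ^-distribʳ-* (n ^ j) m k ⟩
    (n ^ j) ^ k * m ^ k        ≡⟨ cong (_* m ^ k) (trans (^-*-assoc n j k) (cong (n ^_) (*-comm j k))) ⟩
    n ^ (k * j) * m ^ k        ≡⟨ *-comm (n ^ (k * j)) _ ⟩
    m ^ k * n ^ (k * j)        ∎)

-- Primes between x/c and x

pascal : ∀ n k → suc n C suc k ≡ n C k + n C suc k
pascal n k = sym (nCk+nC[k+1]≡[n+1]C[k+1] n k)

nC0≡1 : ∀ n → n C 0 ≡ 1
nC0≡1 n = trans (nCk≡nC[n∸k] {k = 0} {n} z≤n) (nCn≡1 n)

nCk≤2^n : ∀ n k → n C k ≤ 2 ^ n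
nCk≤2^n zero    zero    = ≤-reflexive (nC0≡1 0)
nCk≤2^n zero    (suc k) = ≤-trans (≤-reflexive (k>n⇒nCk≡0 {0} {suc k} z<s)) z≤n
nCk≤2^n (suc n) zero    = ≤-trans (≤-reflexive (nC0≡1 (suc n))) (m^n>0 2 (suc n))
nCk≤2^n (suc n) (suc k) = begin
  suc n C suc k            ≡⟨ pascal n k ⟩
  n C k + n C suc k        ≤⟨ +-mono-≤ (nCk≤2^n n k) (nCk≤2^n n (suc k)) ⟩
  2 ^ n + 2 ^ n            ≡⟨ cong (2 ^ n +_) (+-identityʳ (2 ^ n)) ⟨
  2 ^ suc n                ∎
  where open ≤-Reasoning

0<nCk : ∀ {n k} → k ≤ n → 0 < n C k
0<nCk {n}     {zero}  _         = ≤-reflexive (sym (nC0≡1 n))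
0<nCk {suc n} {suc k} (s≤s k≤n) = begin
  1                  ≤⟨ 0<nCk k≤n ⟩
  n C k              ≤⟨ m≤m+n _ _ ⟩
  n C k + n C suc k  ≡⟨ pascal n k ⟨
  suc n C suc k      ∎
  where open ≤-Reasoning

2^n≤[1+2n]Cn : ∀ n → 2 ^ n ≤ suc (n + n) C n
2^n≤[1+2n]Cn n = ≤-trans (central n) (grow n)
  where
  open ≤-Reasoning
  grow : ∀ n → (n + n) C n ≤ suc (n + n) C n
  grow zero    = ≤-refl
  grow (suc n) = begin
    (suc n + suc n) C suc n  ≤⟨ m≤n+m _ _ ⟩
    (suc n + suc n) C n + (suc n + suc n) C suc n ≡⟨ pascal (suc n + suc n) n ⟨
    suc (suc n + suc n) C suc n ∎
  central : ∀ n → 2 ^ n ≤ (n + n) C n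
  central zero    = ≤-reflexive (sym (nC0≡1 0))
  central (suc n) = begin
    2 ^ suc n                        ≡⟨ cong (2 ^ n +_) (+-identityʳ (2 ^ n)) ⟩
    2 ^ n + 2 ^ n                    ≤⟨ +-mono-≤ (≤-trans (central n) (grow n)) (central n) ⟩
    suc (n + n) C n + (n + n) C n    ≤⟨ +-monoʳ-≤ (suc (n + n) C n) (m≤m+n ((n + n) C n) ((n + n) C suc n)) ⟩
    suc (n + n) C n + ((n + n) C n + (n + n) C suc n) ≡⟨ cong (suc (n + n) C n +_) (pascal (n + n) n) ⟨
    suc (n + n) C n + suc (n + n) C suc n ≡⟨ pascal (suc (n + n)) n ⟨
    suc (suc (n + n)) C suc n        ≡⟨ cong (λ z → suc z C suc n) (+-suc n n) ⟨
    (suc n + suc n) C suc n          ∎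

[1+k]*[1+n]C[1+k]≡[1+n]*nCk : ∀ n k → suc k * (suc n C suc k) ≡ suc n * (n C k)
[1+k]*[1+n]C[1+k]≡[1+n]*nCk n zero = begin
  1 * (suc n C 1)  ≡⟨ *-identityˡ _ ⟩
  suc n C 1        ≡⟨ nC1≡n (suc n) ⟩
  suc n            ≡⟨ *-identityʳ (suc n) ⟨
  suc n * 1        ≡⟨ cong (suc n *_) (nC0≡1 n) ⟨
  suc n * (n C 0)  ∎
  where
  open ≡-Reasoning
[1+k]*[1+n]C[1+k]≡[1+n]*nCk zero (suc k) =
  cong₂ _+_ (k>n⇒nCk≡0 {1} {suc (suc k)} (s≤s z<s)) (trans (cong (suc k *_) (k>n⇒nCk≡0 {1} {suc (suc k)} (s≤s z<s)))
    (trans (*-zeroʳ k) (sym (trans (*-identityˡ _) (k>n⇒nCk≡0 {0} {suc k} z<s)))))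
[1+k]*[1+n]C[1+k]≡[1+n]*nCk (suc n) (suc k) = begin
  suc (suc k) * (suc (suc n) C suc (suc k))
    ≡⟨ cong (suc (suc k) *_) (pascal (suc n) (suc k)) ⟩
  suc (suc k) * (c + suc n C suc (suc k))
    ≡⟨ *-distribˡ-+ (suc (suc k)) c _ ⟩
  (c + suc k * c) + suc (suc k) * (suc n C suc (suc k))
    ≡⟨ cong₂ (λ x y → (c + x) + y) ([1+k]*[1+n]C[1+k]≡[1+n]*nCk n k) ([1+k]*[1+n]C[1+k]≡[1+n]*nCk n (suc k)) ⟩
  (c + suc n * (n C k)) + suc n * (n C suc k)
    ≡⟨ +-assoc c _ _ ⟩
  c + (suc n * (n C k) + suc n * (n C suc k))
    ≡⟨ cong (c +_) (*-distribˡ-+ (suc n) (n C k) _) ⟨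
  c + suc n * (n C k + n C suc k)
    ≡⟨ cong (λ z → c + suc n * z) (pascal n k) ⟨
  suc (suc n) * c ∎
  where
  open ≡-Reasoning
  c = suc n C suc k

-- The absorption identity (n + 1 - k) C(n+1, k) = (n + 1) C(n, k) with the subtraction moved
-- across.
[1+n]*nCk+k*[1+n]Ck : ∀ n k → suc n * (n C k) + k * (suc n C k) ≡ suc n * (suc n C k)
[1+n]*nCk+k*[1+n]Ck n zero = trans (+-identityʳ _) (cong (suc n *_) (trans (nC0≡1 n) (sym (nC0≡1 (suc n)))))
[1+n]*nCk+k*[1+n]Ck n (suc k) = begin
  suc n * (n C suc k) + suc k * (suc n C suc k)
    ≡⟨ cong (suc n * (n C suc k) +_) ([1+k]*[1+n]C[1+k]≡[1+n]*nCk n k) ⟩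
  suc n * (n C suc k) + suc n * (n C k)
    ≡⟨ *-distribˡ-+ (suc n) (n C suc k) _ ⟨
  suc n * (n C suc k + n C k)
    ≡⟨ cong (suc n *_) (trans (+-comm (n C suc k) _) (sym (pascal n k))) ⟩
  suc n * (suc n C suc k) ∎
  where open ≡-Reasoning

-- The Leibniz harmonic triangle: 1/D = 1/A − 1/B for three neighbouring entries,
-- so a common multiple of 1, …, n+1 is a multiple of every entry of row n.
leibniz-∣ : ∀ M k n → k ≤ n → (∀ j → 0 < j → j ≤ suc n → j ∣ M) → suc n * (n C k) ∣ M
leibniz-∣ M zero n _ h =
  subst (_∣ M) (sym (trans (cong (suc n *_) (nC0≡1 n)) (*-identityʳ (suc n)))) (h (suc n) z<s ≤-refl)
leibniz-∣ M (suc k) (suc n) (s≤s k≤n) h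
  with divides α M≡αA ← leibniz-∣ M k n k≤n (λ j 0<j j≤n → h j 0<j (m≤n⇒m≤1+n j≤n))
     | divides β M≡βB ← leibniz-∣ M k (suc n) (m≤n⇒m≤1+n k≤n) h =
  ∣m+n∣m⇒∣n (subst (D ∣_) key (n∣m*n α)) (n∣m*n β)
  where
  c = n C k
  b = suc n C k
  d = suc n C suc k
  A = suc n * c
  B = suc (suc n) * b
  D = suc (suc n) * d
  open ≡-Reasoning
  c≢0 = >-nonZero (0<nCk k≤n)
  b≢0 = >-nonZero (0<nCk (m≤n⇒m≤1+n k≤n))
  instance
    _ = m*n≢0 (suc n) c {{_}} {{c≢0}}
    _ = m*n≢0 (suc (suc n)) b {{_}} {{b≢0}}
    AB≢0 = m*n≢0 A B
  core : A * b + d * A ≡ suc (suc n) * (b * d)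
  core = +-cancelʳ-≡ (k * b * d) _ _ (begin
    A * b + d * A + k * b * d       ≡⟨ rearr A b d k ⟩
    A * b + d * (A + k * b)         ≡⟨ cong₂ (λ x y → x * b + d * y) (sym ([1+k]*[1+n]C[1+k]≡[1+n]*nCk n k)) ([1+n]*nCk+k*[1+n]Ck n k) ⟩
    suc k * d * b + d * (suc n * b) ≡⟨ rearr2 n k b d ⟩
    suc (suc n) * (b * d) + k * b * d ∎)
    where
    rearr : ∀ A b d k → A * b + d * A + k * b * d ≡ A * b + d * (A + k * b)
    rearr = solve-∀
    rearr2 : ∀ n k b d → suc k * d * b + d * (suc n * b) ≡ suc (suc n) * (b * d) + k * b * d
    rearr2 = solve-∀
  neighbours : D * B ≡ A * B + D * A
  neighbours = begin
    D * B                                ≡⟨ r1 (suc (suc n)) b d ⟩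
    suc (suc n) * (suc (suc n) * (b * d)) ≡⟨ cong (suc (suc n) *_) core ⟨
    suc (suc n) * (A * b + d * A)        ≡⟨ r2 (suc (suc n)) A b d ⟩
    A * B + D * A                        ∎
    where
    r1 : ∀ x b d → x * d * (x * b) ≡ x * (x * (b * d))
    r1 = solve-∀
    r2 : ∀ x A b d → x * (A * b + d * A) ≡ A * (x * b) + x * d * A
    r2 = solve-∀
  -- Multiplying 1/D = 1/A - 1/B by M gives M/D = α - β, here without subtraction.
  key : α * D ≡ β * D + M
  key = *-cancelʳ-≡ _ _ (A * B) (begin
    α * D * (A * B)          ≡⟨ r1 α D A B ⟩
    α * A * (D * B)          ≡⟨ cong₂ _*_ (sym M≡αA) neighbours ⟩
    M * (A * B + D * A)      ≡⟨ *-distribˡ-+ M (A * B) _ ⟩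
    M * (A * B) + M * (D * A) ≡⟨ cong (λ z → M * (A * B) + z * (D * A)) M≡βB ⟩
    M * (A * B) + β * B * (D * A) ≡⟨ r2 M A B β D ⟩
    (β * D + M) * (A * B)    ∎)
    where
    r1 : ∀ α D A B → α * D * (A * B) ≡ α * A * (D * B)
    r1 = solve-∀
    r2 : ∀ M A B β D → M * (A * B) + β * B * (D * A) ≡ (β * D + M) * (A * B)
    r2 = solve-∀

-- Primorials and least common multiples as products over primes

∏ : (ℕ → ℕ) → ℕ → ℕ
∏ f zero    = 1
∏ f (suc n) = f (suc n) * ∏ f n

∏>0 : ∀ f → (∀ j → 0 < f j) → ∀ n → 0 < ∏ f n
∏>0 f pos zero    = z<s
∏>0 f pos (suc n) = *-mono-≤ (pos (suc n)) (∏>0 f pos n)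

f∣∏ : ∀ f n j → 0 < j → j ≤ n → f j ∣ ∏ f n
f∣∏ f zero    (suc j) _ ()
f∣∏ f (suc n) j 0<j j≤1+n with m≤n⇒m<n∨m≡n j≤1+n
... | inj₁ (s≤s j≤n) = ∣n⇒∣m*n (f (suc n)) (f∣∏ f n j 0<j j≤n)
... | inj₂ refl      = m∣m*n _

primePart : ℕ → ℕ
primePart j with prime? j
... | yes _ = j
... | no  _ = 1

0<prime : ∀ {p} → Prime p → 0 < p
0<prime {p} pp = >-nonZero⁻¹ p {{prime⇒nonZero pp}}

primePart>0 : ∀ j → 0 < primePart j
primePart>0 j with prime? j
... | yes pj = 0<prime pj
... | no  _  = z<s

primePart∤ : ∀ {p j} → Prime p → j < p → ¬ (p ∣ primePart j)
primePart∤ {p} {j} pp j<p p∣ with prime? j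
... | yes pj = <⇒≱ j<p (∣⇒≤ {{prime⇒nonZero pj}} p∣)
... | no  _  = ¬prime[1] (subst Prime (∣1⇒≡1 p∣) pp)

primorial : ℕ → ℕ
primorial = ∏ primePart

prime∤⇒coprime : ∀ {p m} → Prime p → ¬ (p ∣ m) → Coprime p m
prime∤⇒coprime pp p∤m (d∣p , d∣m) with prime⇒irreducible pp d∣p
... | inj₁ d≡1  = d≡1
... | inj₂ refl = contradiction d∣m p∤m

coprime-*-∣ : ∀ {m n k} → Coprime m n → m ∣ k → n ∣ k → m * n ∣ k
coprime-*-∣ {m} {n} c (divides x refl) n∣k =
  subst (_∣ x * m) (*-comm n m)
    (*-monoˡ-∣ m (coprime-divisor (coprime-sym c) (subst (n ∣_) (*-comm x m) n∣k)))

prime∣n!⇒≤ : ∀ {p} → Prime p → ∀ n → p ∣ n ! → p ≤ n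
prime∣n!⇒≤ pp zero    p∣ = contradiction (subst Prime (∣1⇒≡1 p∣) pp) ¬prime[1]
prime∣n!⇒≤ pp (suc n) p∣ with euclidsLemma (suc n) (n !) pp p∣
... | inj₁ p∣n = ∣⇒≤ p∣n
... | inj₂ p∣n! = m≤n⇒m≤1+n (prime∣n!⇒≤ pp n p∣n!)

nCk*k![n∸k]!≡n! : ∀ {n k} → k ≤ n → (n C k) * (k ! * (n ∸ k) !) ≡ n !
nCk*k![n∸k]!≡n! {n} {k} k≤n = trans (cong (_* (k ! * (n ∸ k) !)) (nCk≡n!/k![n-k]! k≤n)) (m/n*n≡m (k![n∸k]!∣n! k≤n))
  where instance _ = k !* (n ∸ k) !≢0

-- Such a prime divides (2m)! = C(2m, m) · m! · m! but, exceeding m, not m!.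
prime∣2mCm : ∀ {p} m → Prime p → m < p → p ≤ m + m → p ∣ (m + m) C m
prime∣2mCm {p} m pp m<p p≤2m
  with euclidsLemma ((m + m) C m) (m ! * m !) pp
         (subst (p ∣_) (trans (sym (nCk*k![n∸k]!≡n! (m≤m+n m m))) (cong (λ z → ((m + m) C m) * (m ! * z !)) (m+n∸m≡n m m)))
           (∣-trans (n∣n! pp) (m≤n⇒m!∣n! p≤2m)))
  where
  n∣n! : ∀ {p} → Prime p → p ∣ p !
  n∣n! {zero}  pp = contradiction pp ¬prime[0]
  n∣n! {suc p} pp = m∣m*n (p !)
... | inj₁ p∣C = p∣C
... | inj₂ p∣m!m! with euclidsLemma (m !) (m !) pp p∣m!m!
...   | inj₁ p∣m! = contradiction (prime∣n!⇒≤ pp m p∣m!) (<⇒≱ m<p)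
...   | inj₂ p∣m! = contradiction (prime∣n!⇒≤ pp m p∣m!) (<⇒≱ m<p)

∏primePart∤ : ∀ {p} f → Prime p → ∀ n → (∀ j → j ≤ n → f j < p) → ¬ (p ∣ ∏ (primePart ∘ f) n)
∏primePart∤ f pp zero    _ p∣ = ¬prime[1] (subst Prime (∣1⇒≡1 p∣) pp)
∏primePart∤ f pp (suc n) f<p p∣ with euclidsLemma (primePart (f (suc n))) _ pp p∣
... | inj₁ p∣f = primePart∤ pp (f<p (suc n) ≤-refl) p∣f
... | inj₂ p∣∏ = ∏primePart∤ f pp n (λ j j≤n → f<p j (m≤n⇒m≤1+n j≤n)) p∣∏

primes∣2mCm : ∀ m j → j ≤ m → ∏ (primePart ∘ (m +_)) j ∣ (m + m) C m
primes∣2mCm m zero    _ = 1∣ _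
primes∣2mCm m (suc j) j<m with IH ← primes∣2mCm m j (<⇒≤ j<m) | prime? (m + suc j)
... | no  _  = subst (_∣ (m + m) C m) (sym (*-identityˡ _)) IH
... | yes pp = coprime-*-∣
  (prime∤⇒coprime pp (∏primePart∤ (m +_) pp j (λ i i≤j → +-monoʳ-< m (s≤s i≤j))))
  (prime∣2mCm m pp (m<m+n m z<s) (+-monoʳ-≤ m j<m)) IH

primorial-+ : ∀ m j → primorial (m + j) ≡ ∏ (primePart ∘ (m +_)) j * primorial m
primorial-+ m zero    = trans (cong primorial (+-identityʳ m)) (sym (*-identityˡ _))
primorial-+ m (suc j) = begin
  primorial (m + suc j)                          ≡⟨ cong primorial (+-suc m j) ⟩
  primePart (suc (m + j)) * primorial (m + j)    ≡⟨ cong₂ (λ x y → primePart x * y) (sym (+-suc m j)) (primorial-+ m j) ⟩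
  primePart (m + suc j) * (∏ (primePart ∘ (m +_)) j * primorial m) ≡⟨ *-assoc (primePart (m + suc j)) _ _ ⟨
  ∏ (primePart ∘ (m +_)) (suc j) * primorial m   ∎
  where open ≡-Reasoning

-- The primes in (m, 2m] multiply to a divisor of C(2m, m) ≤ 4^m. Doubling m repeatedly bounds the
-- primorial of a power of 2 by 4 to that power.
primorial-2^ : ∀ i → primorial (2 ^ i) ≤ 2 ^ (2 * 2 ^ i)
primorial-2^ zero    = z<s
primorial-2^ (suc i) = begin
  primorial (2 ^ suc i)   ≡⟨ cong (λ z → primorial (m + z)) (+-identityʳ m) ⟩
  primorial (m + m)       ≡⟨ primorial-+ m m ⟩
  ∏ (primePart ∘ (m +_)) m * primorial m ≤⟨ *-mono-≤ (∣⇒≤ {{>-nonZero (0<nCk (m≤m+n m m))}} (primes∣2mCm m m ≤-refl)) (primorial-2^ i) ⟩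
  ((m + m) C m) * 2 ^ (2 * m) ≤⟨ *-monoˡ-≤ (2 ^ (2 * m)) (nCk≤2^n (m + m) m) ⟩
  2 ^ (m + m) * 2 ^ (2 * m) ≡⟨ ^-distribˡ-+-* 2 (m + m) (2 * m) ⟨
  2 ^ (m + m + 2 * m)     ≡⟨ cong (2 ^_) (arith m) ⟩
  2 ^ (2 * 2 ^ suc i)     ∎
  where
  open ≤-Reasoning
  m = 2 ^ i
  arith : ∀ m → m + m + 2 * m ≡ 2 * (2 * m)
  arith = solve-∀

maxPower : ℕ → ℕ → ℕ → ℕ
maxPower p N zero = 1
maxPower p N (suc k) with p ^ suc k ≤? N
... | yes _ = p ^ suc k
... | no  _ = maxPower p N k

^∣maxPower : ∀ p N a k → p ^ a ≤ N → a ≤ k → p ^ a ∣ maxPower p N k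
^∣maxPower p N .zero zero _ z≤n = ∣-refl
^∣maxPower p N a (suc k) pᵃ≤N a≤1+k with p ^ suc k ≤? N
... | yes _ = subst (p ^ a ∣_) (trans (sym (^-distribˡ-+-* p a (suc k ∸ a))) (cong (p ^_) (m+[n∸m]≡n a≤1+k))) (m∣m*n _)
... | no p≰ with m≤n⇒m<n∨m≡n a≤1+k
...   | inj₁ (s≤s a≤k) = ^∣maxPower p N a k pᵃ≤N a≤k
...   | inj₂ refl      = contradiction pᵃ≤N p≰

maxPower≤ : ∀ p N k → 0 < N → maxPower p N k ≤ N
maxPower≤ p N zero    0<N = 0<N
maxPower≤ p N (suc k) 0<N with p ^ suc k ≤? N
... | yes p≤ = p≤
... | no  _  = maxPower≤ p N k 0<N

-- Primes above √N enter the least common multiple only to the first power, so their contribution is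
-- controlled by a primorial.
maxPower≤p : ∀ p N k → 0 < p → N < p * p → maxPower p N k ≤ p
maxPower≤p p N zero    0<p _ = 0<p
maxPower≤p p N (suc k) 0<p N<p² with p ^ suc k ≤? N
maxPower≤p p N (suc zero)    0<p N<p² | yes _ = ≤-reflexive (*-identityʳ p)
maxPower≤p p N (suc (suc k)) 0<p N<p² | yes p≤ = contradiction N<p² (≤⇒≯ (≤-trans (*-monoʳ-≤ p p≤p^1+k) p≤))
  where
  p≤p^1+k : p ≤ p * p ^ k
  p≤p^1+k = subst (_≤ p * p ^ k) (*-identityʳ p) (*-monoʳ-≤ p (m^n>0 p {{>-nonZero 0<p}} k))
... | no  _  = maxPower≤p p N k 0<p N<p²

-- `∏ (lcmPart N) N` is lcm(1, ..., N), written as the product of the largest prime powers up to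
-- `N`.
lcmPart : ℕ → ℕ → ℕ
lcmPart N j with prime? j
... | yes _ = maxPower j N N
... | no  _ = 1

lcmPart≤ : ∀ N j → 0 < N → lcmPart N j ≤ N
lcmPart≤ N j 0<N with prime? j
... | yes _ = maxPower≤ j N N 0<N
... | no  _ = 0<N

lcmPart≤primePart : ∀ N j → N < j * j → lcmPart N j ≤ primePart j
lcmPart≤primePart N j N<j² with prime? j
... | yes pj = maxPower≤p j N N (0<prime pj) N<j²
... | no  _  = z<s

lcmPart>0 : ∀ N j → 0 < lcmPart N j
lcmPart>0 N j with prime? j
... | yes pj = pos N
  where
  pos : ∀ k → 0 < maxPower j N k
  pos zero = z<s
  pos (suc k) with j ^ suc k ≤? N
  ... | yes _ = m^n>0 j {{prime⇒nonZero pj}} (suc k)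
  ... | no  _ = pos k
... | no  _ = z<s

n<2^n : ∀ n → n < 2 ^ n
n<2^n zero    = z<s
n<2^n (suc n) = begin
  suc (suc n)            ≤⟨ +-mono-≤ (m^n>0 2 n) (n<2^n n) ⟩
  2 ^ n + 2 ^ n          ≡⟨ cong (2 ^ n +_) (+-identityʳ (2 ^ n)) ⟨
  2 ^ suc n              ∎
  where open ≤-Reasoning

prime-^∣lcmPart : ∀ {p N} → Prime p → ∀ a → p ^ a ≤ N → p ^ a ∣ lcmPart N p
prime-^∣lcmPart {p} {N} pp a pᵃ≤N with prime? p
... | no ¬pp = contradiction pp ¬pp
... | yes _  = ^∣maxPower p N a N pᵃ≤N (<⇒≤ (begin-strict
  a      <⟨ n<2^n a ⟩
  2 ^ a  ≤⟨ ^-monoˡ-≤ a (nonTrivial⇒n>1 p {{prime⇒nonTrivial pp}}) ⟩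
  p ^ a  ≤⟨ pᵃ≤N ⟩
  N      ∎))
  where open ≤-Reasoning

primeDivisor : ∀ n → 1 < n → ∃ λ p → Prime p × p ∣ n
primeDivisor 1 (s≤s ())
primeDivisor n@(suc (suc _)) _ with factorise n
... | record { factors = [] ; isFactorisation = () }
... | record { factors = p ∷ ps ; isFactorisation = eq ; factorsPrime = pp ∷ _ } =
  p , pp , subst (p ∣_) (sym eq) (m∣m*n _)

primePowerSplit : ∀ {p} → Prime p → ∀ n → 0 < n → ∃ λ a → ∃ λ m → n ≡ p ^ a * m × ¬ (p ∣ m)
primePowerSplit {p} pp = <-rec _ λ n rec 0<n → step n (λ {m} → rec {m}) 0<n
  where
  step : ∀ n → (∀ {m} → m < n → 0 < m → ∃ λ a → ∃ λ k → m ≡ p ^ a * k × ¬ (p ∣ k)) →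
         0 < n → ∃ λ a → ∃ λ k → n ≡ p ^ a * k × ¬ (p ∣ k)
  step n rec 0<n with p ∣? n
  ... | no p∤n = 0 , n , sym (*-identityˡ n) , p∤n
  ... | yes p∣n@(divides x refl)
    with a , k , x≡ , p∤k ← rec (quotient-< p∣n {{prime⇒nonTrivial pp}} {{>-nonZero 0<n}})
                                (>-nonZero⁻¹ x {{quotient≢0 p∣n {{>-nonZero 0<n}}}})
    = suc a , k , trans (cong (_* p) x≡) (trans (*-comm (p ^ a * k) p) (sym (*-assoc p (p ^ a) k))) , p∤k

coprime-^ : ∀ {p m} → Coprime p m → ∀ a → Coprime (p ^ a) m
coprime-^ c zero    (d∣1 , _) = ∣1⇒≡1 d∣1
coprime-^ c (suc a) (d∣ , d∣m) =
  coprime-^ c a (coprime-divisor (λ (e∣d , e∣p) → c (e∣p , ∣-trans e∣d d∣m)) d∣ , d∣m)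

-- Strong induction: a prime divisor is split off with its full power, which divides one factor of
-- the product; the cofactor is smaller and coprime to it.
∣∏lcmPart : ∀ N m → 0 < m → m ≤ N → m ∣ ∏ (lcmPart N) N
∣∏lcmPart N = <-rec _ λ m rec → step m (λ {k} → rec {k})
  where
  step : ∀ m → (∀ {k} → k < m → 0 < k → k ≤ N → k ∣ ∏ (lcmPart N) N) → 0 < m → m ≤ N → m ∣ ∏ (lcmPart N) N
  step 1 rec _ _ = 1∣ _
  step m@(suc (suc _)) rec 0<m m≤N
    with p , pp , p∣m ← primeDivisor m (s≤s z<s)
    with primePowerSplit pp m 0<m
  ... | zero , k , m≡ , p∤k = contradiction (subst (p ∣_) (trans m≡ (*-identityˡ k)) p∣m) p∤k
  ... | suc a , k , m≡ , p∤k = subst (_∣ ∏ (lcmPart N) N) (sym m≡)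
    (coprime-*-∣ (coprime-^ (prime∤⇒coprime pp p∤k) (suc a))
      (∣-trans (prime-^∣lcmPart pp (suc a) pᵃ≤N) (f∣∏ (lcmPart N) N p (0<prime pp) p≤N))
      (rec k<m 0<k (≤-trans (<⇒≤ k<m) m≤N)))
    where
    instance
      m≢0 = >-nonZero 0<m
      p≢0 = prime⇒nonZero pp
    pᵃ∣m : p ^ suc a ∣ m
    pᵃ∣m = subst (p ^ suc a ∣_) (sym m≡) (m∣m*n k)
    pᵃ≤N = ≤-trans (∣⇒≤ pᵃ∣m) m≤N
    p≤N = ≤-trans (∣⇒≤ p∣m) m≤N
    k∣m = divides (p ^ suc a) m≡
    0<k : 0 < k
    0<k = n≢0⇒n>0 λ { refl → contradiction (trans m≡ (*-zeroʳ (p ^ suc a))) (≢-nonZero⁻¹ m) }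
    k<m : k < m
    k<m = subst (k <_) (sym m≡) (m<n*m k (p ^ suc a) 0<k
      (<-≤-trans (nonTrivial⇒n>1 p {{prime⇒nonTrivial pp}}) (subst (_≤ p * p ^ a) (*-identityʳ p) (*-monoʳ-≤ p (m^n>0 p a)))))
      where
      m<n*m : ∀ m n → 0 < m → 1 < n → m < n * m
      m<n*m m n 0<m 1<n = subst (_< n * m) (*-identityˡ m) (*-monoˡ-< m {{>-nonZero 0<m}} 1<n)

-- The common multiple of 1, ..., 2n + 2 is a multiple of the entry (2n + 2) C(2n+1, n) of the
-- Leibniz triangle, which is already large.
2^n≤∏lcmPart : ∀ n → 2 ^ suc n ≤ ∏ (lcmPart (2 * suc n)) (2 * suc n)
2^n≤∏lcmPart n = begin
  2 * 2 ^ n                          ≤⟨ *-mono-≤ {2} {suc (suc (n + n))} (s≤s (s≤s z≤n)) (2^n≤[1+2n]Cn n) ⟩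
  suc (suc (n + n)) * (suc (n + n) C n) ≤⟨ ∣⇒≤ {{>-nonZero (∏>0 (lcmPart N) (lcmPart>0 N) N)}} (leibniz-∣ M n (suc (n + n)) (m≤n⇒m≤1+n (m≤m+n n n))
       λ j 0<j j≤ → ∣∏lcmPart N j 0<j (subst (j ≤_) (arith n) j≤)) ⟩
  M ∎
  where
  open ≤-Reasoning
  N = 2 * suc n
  M = ∏ (lcmPart N) N
  arith : ∀ n → suc (suc (n + n)) ≡ 2 * suc n
  arith = solve-∀

-- Let N = s². Each index up to `s` contributes at most N; an index above `s` exceeds √N and
-- contributes at most its prime part; above `y` there are no primes and every factor is 1.
∏lcmPart≤ : ∀ s y → (∀ j → y < j → j ≤ s * s → ¬ Prime j) → 0 < s →
            ∀ k → k ≤ s * s → ∏ (lcmPart (s * s)) k ≤ (s * s) ^ s * primorial y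
∏lcmPart≤ s y none 0<s k k≤N = ≤-trans (go k k≤N) (*-mono-≤ (^-monoʳ-≤ N {{N≢0}} (m⊓n≤n k s)) (mono (m⊓n≤n k y)))
  where
  open ≤-Reasoning
  N = s * s
  0<N : 0 < N
  0<N = *-mono-≤ 0<s 0<s
  N≢0 = >-nonZero 0<N
  mono : ∀ {a b} → a ≤ b → primorial a ≤ primorial b
  mono {b = b} z≤n = ∏>0 primePart primePart>0 b
  mono {suc a} {suc b} (s≤s a≤b) with m≤n⇒m<n∨m≡n a≤b
  ... | inj₂ refl = ≤-refl
  ... | inj₁ a<b  = ≤-trans (mono a<b) (m≤n*m (primorial b) (primePart (suc b)) {{>-nonZero (primePart>0 (suc b))}})
  lcmPart≡1 : ∀ j → y < j → j ≤ N → lcmPart N j ≡ 1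
  lcmPart≡1 j y<j j≤N with prime? j
  ... | yes pj = contradiction pj (none j y<j j≤N)
  ... | no  _  = refl
  go : ∀ k → k ≤ N → ∏ (lcmPart N) k ≤ N ^ (k ⊓ s) * primorial (k ⊓ y)
  go zero _ = ≤-refl
  go (suc k) k<N with IH ← go k (<⇒≤ k<N) | suc k ≤? s
  ... | yes k<s = begin
    lcmPart N (suc k) * ∏ (lcmPart N) k          ≤⟨ *-mono-≤ (lcmPart≤ N (suc k) 0<N) IH ⟩
    N * (N ^ (k ⊓ s) * primorial (k ⊓ y))        ≡⟨ *-assoc N _ _ ⟨
    N ^ suc (k ⊓ s) * primorial (k ⊓ y)          ≡⟨ cong (λ z → N ^ z * primorial (k ⊓ y)) (trans (cong suc (m≤n⇒m⊓n≡m (<⇒≤ k<s))) (sym (m≤n⇒m⊓n≡m k<s))) ⟩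
    N ^ (suc k ⊓ s) * primorial (k ⊓ y)          ≤⟨ *-monoʳ-≤ (N ^ (suc k ⊓ s)) (mono (⊓-monoˡ-≤ y (n≤1+n k))) ⟩
    N ^ (suc k ⊓ s) * primorial (suc k ⊓ y)      ∎
  ... | no k≮s with suc k ≤? y
  ...   | yes k<y = begin
    lcmPart N (suc k) * ∏ (lcmPart N) k ≤⟨ *-mono-≤ (lcmPart≤primePart N (suc k) (*-mono-< s<1+k s<1+k)) IH ⟩
    primePart (suc k) * (N ^ (k ⊓ s) * primorial (k ⊓ y)) ≡⟨ cong (λ z → primePart (suc k) * (N ^ (k ⊓ s) * primorial z)) (m≤n⇒m⊓n≡m (<⇒≤ k<y)) ⟩
    primePart (suc k) * (N ^ (k ⊓ s) * primorial k) ≡⟨ swap (primePart (suc k)) (N ^ (k ⊓ s)) (primorial k) ⟩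
    N ^ (k ⊓ s) * primorial (suc k) ≤⟨ *-mono-≤ (^-monoʳ-≤ N {{N≢0}} (⊓-monoˡ-≤ s (n≤1+n k))) (≤-reflexive (cong primorial (sym (m≤n⇒m⊓n≡m k<y)))) ⟩
    N ^ (suc k ⊓ s) * primorial (suc k ⊓ y) ∎
    where
    s<1+k = ≰⇒> k≮s
    swap : ∀ a b c → a * (b * c) ≡ b * (a * c)
    swap = solve-∀
  ...   | no k≮y = begin
    lcmPart N (suc k) * ∏ (lcmPart N) k ≡⟨ trans (cong (_* ∏ (lcmPart N) k) (lcmPart≡1 (suc k) (≰⇒> k≮y) k<N)) (*-identityˡ _) ⟩
    ∏ (lcmPart N) k ≤⟨ IH ⟩
    N ^ (k ⊓ s) * primorial (k ⊓ y) ≤⟨ *-mono-≤ (^-monoʳ-≤ N {{N≢0}} (⊓-monoˡ-≤ s (n≤1+n k))) (mono (⊓-monoˡ-≤ y (n≤1+n k))) ⟩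
    N ^ (suc k ⊓ s) * primorial (suc k ⊓ y) ∎

findPrime : ∀ y k → (∃ λ p → Prime p × y < p × p ≤ k) ⊎ (∀ j → y < j → j ≤ k → ¬ Prime j)
findPrime y zero    = inj₂ λ j y<j j≤0 _ → contradiction (≤-trans y<j j≤0) λ ()
findPrime y (suc k) with findPrime y k
... | inj₁ (p , pp , y<p , p≤k) = inj₁ (p , pp , y<p , m≤n⇒m≤1+n p≤k)
... | inj₂ none with y <? suc k | prime? (suc k)
...   | yes y<k | yes pk = inj₁ (suc k , pk , y<k , ≤-refl)
...   | no  y≮k | _      = inj₂ λ j y<j j≤k → contradiction (<-≤-trans y<j j≤k) y≮k
...   | yes _   | no ¬pk = inj₂ λ j y<j j≤k pj → excluded (m≤n⇒m<n∨m≡n j≤k) y<j pj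
  where
  excluded : ∀ {j} → j < suc k ⊎ j ≡ suc k → y < j → ¬ Prime j
  excluded (inj₁ (s≤s j≤k)) y<j pj = none _ y<j j≤k pj
  excluded (inj₂ refl)      _   pj = ¬pk pj

-- The exponent e = 4 is the first with 2e + 4 < 2^e; the offset 4 in the exponents of the prime
-- intervals comes from here.
linear<2^ : ∀ i → 2 * (4 + i) + 4 < 2 ^ (4 + i)
linear<2^ zero    = m≤m+n 13 3
linear<2^ (suc i) = begin-strict
  2 * (5 + i) + 4                  ≡⟨ arith i ⟩
  2 * (4 + i) + 4 + 2              <⟨ +-mono-<-≤ (linear<2^ i) (≤-trans (s≤s (s≤s z≤n)) (n<2^n (4 + i))) ⟩
  2 ^ (4 + i) + 2 ^ (4 + i)        ≡⟨ cong (2 ^ (4 + i) +_) (+-identityʳ (2 ^ (4 + i))) ⟨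
  2 ^ (5 + i)                      ∎
  where
  open ≤-Reasoning
  arith : ∀ i → 2 * (5 + i) + 4 ≡ 2 * (4 + i) + 4 + 2
  arith = solve-∀

-- Otherwise, with N = 16y, lcm(1, ..., N) would lie between 2^(8y) and N^(√N) · 4^y, whose
-- logarithm to base 2 is 2y plus a term of order √y log y. With 4y for 16y the lower bound would be
-- only 2^(2y), no better than the primorial.
prime∈[4^e,16*4^e] : ∀ i → let y = 2 ^ (4 + i) * 2 ^ (4 + i) in ∃ λ p → Prime p × y < p × p ≤ 16 * y
prime∈[4^e,16*4^e] i with findPrime (2 ^ (4 + i) * 2 ^ (4 + i)) (16 * (2 ^ (4 + i) * 2 ^ (4 + i)))
... | inj₁ found = found
... | inj₂ none  = contradiction exponents (<⇒≱ small)
  where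
  e = 4 + i
  z = 2 ^ e
  y = z * z
  s = 2 ^ (e + 2)
  s≡4z : s ≡ 4 * z
  s≡4z = trans (^-distribˡ-+-* 2 e 2) (*-comm z 4)
  s²≡ : s * s ≡ 16 * y
  s²≡ = trans (cong₂ _*_ s≡4z s≡4z) (arith z)
    where
    arith : ∀ z → 4 * z * (4 * z) ≡ 16 * (z * z)
    arith = solve-∀
  0<y : 0 < y
  0<y = *-mono-≤ (m^n>0 2 e) (m^n>0 2 e)
  8y≡ : suc (pred (8 * y)) ≡ 8 * y
  8y≡ = suc-pred (8 * y) {{m*n≢0 8 y {{_}} {{>-nonZero 0<y}}}}
  N≡ : 2 * suc (pred (8 * y)) ≡ s * s
  N≡ = trans (cong (2 *_) 8y≡) (trans (sym (*-assoc 2 8 y)) (sym s²≡))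
  open ≤-Reasoning
  powers : 2 ^ (8 * y) ≤ 2 ^ ((e + 2 + (e + 2)) * s + 2 * y)
  powers = begin
    2 ^ (8 * y)                            ≡⟨ cong (2 ^_) 8y≡ ⟨
    2 ^ suc (pred (8 * y))                 ≤⟨ 2^n≤∏lcmPart (pred (8 * y)) ⟩
    ∏ (lcmPart _) (2 * suc (pred (8 * y))) ≡⟨ cong (λ N → ∏ (lcmPart N) N) N≡ ⟩
    ∏ (lcmPart (s * s)) (s * s)            ≤⟨ ∏lcmPart≤ s y (λ j y<j j≤ → none j y<j (subst (j ≤_) s²≡ j≤)) (m^n>0 2 (e + 2)) (s * s) ≤-refl ⟩
    (s * s) ^ s * primorial y              ≡⟨ cong₂ (λ a b → a ^ s * primorial b) (sym (^-distribˡ-+-* 2 (e + 2) (e + 2))) (sym (^-distribˡ-+-* 2 e e)) ⟩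
    (2 ^ (e + 2 + (e + 2))) ^ s * primorial (2 ^ (e + e)) ≤⟨ *-mono-≤ (≤-reflexive (^-*-assoc 2 (e + 2 + (e + 2)) s)) (primorial-2^ (e + e)) ⟩
    2 ^ ((e + 2 + (e + 2)) * s) * 2 ^ (2 * 2 ^ (e + e)) ≡⟨ ^-distribˡ-+-* 2 ((e + 2 + (e + 2)) * s) _ ⟨
    2 ^ ((e + 2 + (e + 2)) * s + 2 * 2 ^ (e + e)) ≡⟨ cong (λ b → 2 ^ ((e + 2 + (e + 2)) * s + 2 * b)) (^-distribˡ-+-* 2 e e) ⟩
    2 ^ ((e + 2 + (e + 2)) * s + 2 * y)    ∎
  exponents : 8 * y ≤ (e + 2 + (e + 2)) * s + 2 * y
  exponents = ≮⇒≥ λ lt → <⇒≱ (^-monoʳ-< 2 (s≤s z<s) lt) powers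
  small : (e + 2 + (e + 2)) * s + 2 * y < 8 * y
  small = begin-strict
    (e + 2 + (e + 2)) * s + 2 * y     ≡⟨ cong (λ s → (e + 2 + (e + 2)) * s + 2 * y) s≡4z ⟩
    (e + 2 + (e + 2)) * (4 * z) + 2 * y ≡⟨ a1 e z ⟩
    4 * ((2 * e + 4) * z) + 2 * (z * z) <⟨ +-monoˡ-< (2 * (z * z)) (*-monoʳ-< 4 (*-monoˡ-< z {{>-nonZero (m^n>0 2 e)}} (linear<2^ i))) ⟩
    4 * (z * z) + 2 * (z * z)         ≤⟨ m≤m+n _ (2 * (z * z)) ⟩
    4 * (z * z) + 2 * (z * z) + 2 * (z * z) ≡⟨ a2 (z * z) ⟩
    8 * y                             ∎
    where
    a1 : ∀ e z → (e + 2 + (e + 2)) * (4 * z) + 2 * (z * z) ≡ 4 * ((2 * e + 4) * z) + 2 * (z * z)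
    a1 = solve-∀
    a2 : ∀ w → 4 * w + 2 * w + 2 * w ≡ 8 * w
    a2 = solve-∀

-- A weak form of Bertrand's postulate; below 16·4⁴ = 4096 the prime 2 will do.
∃c∀x∃prime≤x≤c*prime : ∃ λ c → ∀ x → 2 ≤ x → ∃ λ p → Prime p × p ≤ x × x ≤ c * p
∃c∀x∃prime≤x≤c*prime = c , find
  where
  open ≤-Reasoning
  Y : ℕ → ℕ
  Y i = 2 ^ (4 + i) * 2 ^ (4 + i)
  c = 16 * Y 0
  search : ∀ x k → 16 * Y 0 ≤ x → x < 16 * Y k → ∃ λ p → Prime p × p ≤ x × x ≤ c * p
  search x zero    x≥ x< = contradiction x< (≤⇒≯ x≥)
  search x (suc k) x≥ x< with x <? 16 * Y k
  ... | yes x<′ = search x k x≥ x<′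
  ... | no  x≮ with p , pp , y<p , p≤ ← prime∈[4^e,16*4^e] k =
    p , pp , ≤-trans p≤ (≮⇒≥ x≮) , (begin
      x              ≤⟨ <⇒≤ x< ⟩
      16 * Y (suc k) ≡⟨ arith (2 ^ (4 + k)) ⟩
      64 * Y k       ≤⟨ *-mono-≤ (m≤m+n 64 4032) (<⇒≤ y<p) ⟩
      c * p          ∎)
    where
    arith : ∀ z → 16 * (2 * z * (2 * z)) ≡ 64 * (z * z)
    arith = solve-∀
  find : ∀ x → 2 ≤ x → ∃ λ p → Prime p × p ≤ x × x ≤ c * p
  find x 2≤x with x <? 16 * Y 0
  ... | yes x< = 2 , prime[2] , 2≤x , ≤-trans (<⇒≤ x<) (m≤m*n c 2)
  ... | no  x≮ = search x x (≮⇒≥ x≮) (begin-strict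
    x            <⟨ n<2^n x ⟩
    2 ^ x        ≤⟨ ^-monoʳ-≤ 2 (m≤n+m x 4) ⟩
    2 ^ (4 + x)  ≤⟨ m≤m*n (2 ^ (4 + x)) (2 ^ (4 + x)) {{m^n≢0 2 (4 + x)}} ⟩
    Y x          ≤⟨ m≤n*m (Y x) 16 ⟩
    16 * Y x     ∎)

-- The two constructions with their parameters

complete-hypergraph : ∀ n r → 2 ≤ r → 2 * r ≤ n + 1 → Σ (Hypergraph n) λ H → Admissible n r H × numEdges H ≤ 4 ^ r
complete-hypergraph n r 2≤r 2r≤n+1 =
  let H , adm , few = system⇒hypergraph (completeSystem r 0<r) 0<r size≤ in H , adm , ≤-trans few (begin
    2 ^ pred (2 * r)  ≤⟨ ^-monoʳ-≤ 2 (pred[n]≤n {2 * r}) ⟩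
    2 ^ (2 * r)       ≡⟨ ^-*-assoc 2 2 r ⟨
    4 ^ r             ∎)
  where
  open ≤-Reasoning
  0<r : 0 < r
  0<r = ≤-trans (s≤s z≤n) 2≤r
  size≤ : pred (2 * r) ≤ n
  size≤ = pred-mono-≤ (≤-trans 2r≤n+1 (≤-reflexive (+-comm n 1)))

-- The blown-up plane takes at most 4qr vertices and the rows 2qr, whence 6qr. From 8q ≤ r come t >
-- 0 and the room for three groups among the r rows. As t ≥ 1, polynomial factors in q are absorbed
-- into q^(11t).
plane-hypergraph : ∀ n r q → Prime q → 8 * q ≤ r → 6 * q * r ≤ n →
  ∃ λ t → t * q ≤ r × Σ (Hypergraph n) λ H → Admissible n r H × numEdges H ≤ q ^ (11 * t)
plane-hypergraph n r q q-prime 8q≤r 6qr≤n = t , tq≤r ,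
  subst (λ r → Σ (Hypergraph n) λ H → Admissible n r H × numEdges H ≤ q ^ (11 * t)) r′+d≡r hypergraph
  where
  open ≤-Reasoning
  1<q : 1 < q
  1<q = nonTrivial⇒n>1 q {{prime⇒nonTrivial q-prime}}
  0<q : 0 < q
  0<q = <⇒≤ 1<q
  instance
    q≢0 : NonZero q
    q≢0 = >-nonZero 0<q
  1+q≤2q : suc q ≤ 2 * q
  1+q≤2q = begin
    1 + q        ≤⟨ +-monoˡ-≤ q 0<q ⟩
    q + q        ≡⟨ cong (q +_) (+-identityʳ q) ⟨
    2 * q        ∎
  -- Setting `q` aside before the division and adding it to the remainder puts `d` between `q` and
  -- `2 * q`.
  t = (r ∸ q) / suc q
  e = (r ∸ q) % suc q
  d = q + e
  r′ = suc q * t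
  q≤r : q ≤ r
  q≤r = ≤-trans (m≤n*m q 8) 8q≤r
  r′+d≡r : r′ + d ≡ r
  r′+d≡r = begin-equality
    suc q * t + (q + e)     ≡⟨ a1 q t e ⟩
    q + (e + t * suc q)     ≡⟨ cong (q +_) (m≡m%n+[m/n]*n (r ∸ q) (suc q)) ⟨
    q + (r ∸ q)             ≡⟨ m+[n∸m]≡n q≤r ⟩
    r                       ∎
    where
    a1 : ∀ q t e → suc q * t + (q + e) ≡ q + (e + t * suc q)
    a1 = solve-∀
  r′≤r : r′ ≤ r
  r′≤r = ≤-trans (m≤m+n r′ d) (≤-reflexive r′+d≡r)
  tq≤r : t * q ≤ r
  tq≤r = ≤-trans (≤-trans (≤-reflexive (*-comm t q)) (*-monoˡ-≤ t (n≤1+n q))) r′≤r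
  q≤d : q ≤ d
  q≤d = m≤m+n q e
  d≤2q : d ≤ 2 * q
  d≤2q = begin
    q + e        ≤⟨ +-monoʳ-≤ q (s≤s⁻¹ (m%n<n (r ∸ q) (suc q))) ⟩
    q + q        ≡⟨ cong (q +_) (+-identityʳ q) ⟨
    2 * q        ∎
  0<t : 0 < t
  0<t = m≥n⇒m/n>0 (begin
    suc q          ≤⟨ 1+q≤2q ⟩
    2 * q          ≤⟨ *-monoˡ-≤ q (m≤m+n 2 5) ⟩
    7 * q          ≡⟨ m+n∸m≡n q (7 * q) ⟨
    8 * q ∸ q      ≤⟨ ∸-monoˡ-≤ q 8q≤r ⟩
    r ∸ q          ∎)
  3[1+q]≤r : 3 * suc q ≤ r
  3[1+q]≤r = begin
    3 * suc q      ≤⟨ *-monoʳ-≤ 3 1+q≤2q ⟩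
    3 * (2 * q)    ≡⟨ *-assoc 3 2 q ⟨
    6 * q          ≤⟨ *-monoˡ-≤ q (m≤m+n 6 2) ⟩
    8 * q          ≤⟨ 8q≤r ⟩
    r              ∎
  ρ = r ∸ 3 * suc q
  rows≡r : 3 * suc q + ρ ≡ r
  rows≡r = m+[n∸m]≡n 3[1+q]≤r
  open Block t 0<t using (m)
  open Plane q q-prime t 0<t using (planeShape; planeSystem)
  open Extend q q-prime d ρ q≤d d≤2q planeSystem (trans r′+d≡r (sym rows≡r)) using (extendedShape; extendedSystem)
  size≤ : size extendedShape ≤ n
  size≤ = begin
    m + suc q * (q * m) + (3 * suc q + ρ) * d     ≤⟨ +-mono-≤ planeSize rowsSize ⟩
    4 * (q * r) + 2 * (q * r)                     ≡⟨ a1 q r ⟩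
    6 * q * r                                     ≤⟨ 6qr≤n ⟩
    n                                             ∎
    where
    a1 : ∀ q r → 4 * (q * r) + 2 * (q * r) ≡ 6 * q * r
    a1 = solve-∀
    a2 : ∀ q m → m + suc q * (q * m) + q * m ≡ suc q * suc q * m
    a2 = solve-∀
    a3 : ∀ q s t → 2 * q * s * (2 * t) ≡ 4 * (q * (s * t))
    a3 = solve-∀
    a4 : ∀ q r → r * (2 * q) ≡ 2 * (q * r)
    a4 = solve-∀
    planeSize : m + suc q * (q * m) ≤ 4 * (q * r)
    planeSize = begin
      m + suc q * (q * m)             ≤⟨ m≤m+n _ (q * m) ⟩
      m + suc q * (q * m) + q * m     ≡⟨ a2 q m ⟩
      suc q * suc q * m               ≤⟨ *-mono-≤ (*-monoˡ-≤ (suc q) 1+q≤2q) (pred[n]≤n {2 * t}) ⟩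
      2 * q * suc q * (2 * t)         ≡⟨ a3 q (suc q) t ⟩
      4 * (q * r′)                    ≤⟨ *-monoʳ-≤ 4 (*-monoʳ-≤ q r′≤r) ⟩
      4 * (q * r)                     ∎
    rowsSize : (3 * suc q + ρ) * d ≤ 2 * (q * r)
    rowsSize = begin
      (3 * suc q + ρ) * d   ≡⟨ cong (_* d) rows≡r ⟩
      r * d                 ≤⟨ *-monoʳ-≤ r d≤2q ⟩
      r * (2 * q)           ≡⟨ a4 q r ⟩
      2 * (q * r)           ∎
  lines≤ : suc q + q * q ≤ q ^ 3
  lines≤ = begin
    suc q + q * q          ≤⟨ +-monoˡ-≤ (q * q) (≤-trans 1+q≤2q (*-monoˡ-≤ q 1<q)) ⟩
    q * q + q * q          ≡⟨ a1 (q * q) ⟩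
    2 * (q * q)            ≤⟨ *-monoˡ-≤ (q * q) 1<q ⟩
    q * (q * q)            ≡⟨ cong (λ z → q * (q * z)) (*-identityʳ q) ⟨
    q ^ 3                  ∎
    where
    a1 : ∀ x → x + x ≡ 2 * x
    a1 = solve-∀
  blocks≤ : 2 ^ m * 2 ^ m ≤ q ^ (4 * t)
  blocks≤ = begin
    2 ^ m * 2 ^ m               ≡⟨ ^-distribˡ-+-* 2 m m ⟨
    2 ^ (m + m)                 ≤⟨ ^-monoʳ-≤ 2 (+-mono-≤ (pred[n]≤n {2 * t}) (pred[n]≤n {2 * t})) ⟩
    2 ^ (2 * t + 2 * t)         ≡⟨ cong (2 ^_) (a1 t) ⟩
    2 ^ (4 * t)                 ≤⟨ ^-monoˡ-≤ (4 * t) 1<q ⟩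
    q ^ (4 * t)                 ∎
    where
    a1 : ∀ t → 2 * t + 2 * t ≡ 4 * t
    a1 = solve-∀
  rows≤ : 3 * suc q + ρ ≤ q ^ (2 + t)
  rows≤ = begin
    3 * suc q + ρ          ≡⟨ trans rows≡r (sym r′+d≡r) ⟩
    suc q * t + d          ≤⟨ +-mono-≤ (*-monoˡ-≤ t 1+q≤2q) d≤2q ⟩
    2 * q * t + 2 * q      ≡⟨ a1 q t ⟩
    2 * q * suc t          ≤⟨ *-mono-≤ (*-monoˡ-≤ q 1<q) (≤-trans (n<2^n t) (^-monoˡ-≤ t 1<q)) ⟩
    q * q * q ^ t          ≡⟨ *-assoc q q _ ⟩
    q ^ (2 + t)            ∎
    where
    a1 : ∀ q t → 2 * q * t + 2 * q ≡ 2 * q * suc t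
    a1 = solve-∀
  transversals≤ : 3 * d * (q * q) ^ 3 ≤ q ^ 10
  transversals≤ = begin
    3 * d * (q * q) ^ 3           ≤⟨ *-monoˡ-≤ ((q * q) ^ 3) (*-monoʳ-≤ 3 d≤2q) ⟩
    3 * (2 * q) * (q * q) ^ 3     ≡⟨ a1 q ⟩
    6 * q ^ 7                     ≤⟨ *-monoˡ-≤ (q ^ 7) (≤-trans (m≤m+n 6 2) (^-monoˡ-≤ 3 1<q)) ⟩
    q ^ 3 * q ^ 7                 ≡⟨ ^-distribˡ-+-* q 3 7 ⟨
    q ^ 10                        ∎
    where
    a1 : ∀ q → 3 * (2 * q) * (q * q * (q * q * (q * q * 1))) ≡ 6 * (q * (q * (q * (q * (q * (q * (q * 1)))))))
    a1 = solve-∀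
  edges≤ : (suc q + q * q) * (2 ^ m * 2 ^ m) * (3 * suc q + ρ) + 3 * d * (q * q) ^ 3 ≤ q ^ (11 * t)
  edges≤ = begin
    (suc q + q * q) * (2 ^ m * 2 ^ m) * (3 * suc q + ρ) + 3 * d * (q * q) ^ 3
      ≤⟨ +-mono-≤ (*-mono-≤ (*-mono-≤ lines≤ blocks≤) rows≤) transversals≤ ⟩
    q ^ 3 * q ^ (4 * t) * q ^ (2 + t) + q ^ 10
      ≡⟨ cong (_+ q ^ 10) (trans (cong (_* q ^ (2 + t)) (sym (^-distribˡ-+-* q 3 (4 * t)))) (sym (^-distribˡ-+-* q (3 + 4 * t) (2 + t)))) ⟩
    q ^ (3 + 4 * t + (2 + t)) + q ^ 10
      ≤⟨ +-mono-≤ (^-monoʳ-≤ q exp₁) (^-monoʳ-≤ q (≤-trans (≤-reflexive (sym (*-identityʳ 10))) (*-monoʳ-≤ 10 0<t))) ⟩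
    q ^ (10 * t) + q ^ (10 * t)
      ≡⟨ a1 (q ^ (10 * t)) ⟩
    2 * q ^ (10 * t)
      ≤⟨ *-monoˡ-≤ (q ^ (10 * t)) 1<q ⟩
    q ^ (1 + 10 * t)
      ≤⟨ ^-monoʳ-≤ q (+-monoˡ-≤ (10 * t) 0<t) ⟩
    q ^ (11 * t) ∎
    where
    a1 : ∀ x → x + x ≡ 2 * x
    a1 = solve-∀
    a2 : ∀ t → 3 + 4 * t + (2 + t) ≡ 5 * 1 + 5 * t
    a2 = solve-∀
    a3 : ∀ t → 5 * t + 5 * t ≡ 10 * t
    a3 = solve-∀
    exp₁ : 3 + 4 * t + (2 + t) ≤ 10 * t
    exp₁ = begin
      3 + 4 * t + (2 + t)   ≡⟨ a2 t ⟩
      5 * 1 + 5 * t         ≤⟨ +-monoˡ-≤ (5 * t) (*-monoʳ-≤ 5 0<t) ⟩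
      5 * t + 5 * t         ≡⟨ a3 t ⟩
      10 * t                ∎

  hypergraph : Σ (Hypergraph n) λ H → Admissible n (r′ + d) H × numEdges H ≤ q ^ (11 * t)
  hypergraph =
    let H , adm , few = system⇒hypergraph extendedSystem (≤-trans 0<q (≤-trans q≤d (m≤n+m d r′))) size≤
    in H , adm , ≤-trans few edges≤

-- This is m ≤ (n/r)^(P r²/n), raised to the power n and cleared of the denominator; the factor 1 is
-- the denominator `Q` of the constant C.
UpperBound : ℕ → ℕ → ℕ → ℕ → Set
UpperBound P n r m = m ^ (1 * n) * r ^ (P * (r * r)) ≤ n ^ (P * (r * r))

-- As n/r ≥ 1, a larger exponent weakens the bound. The dense and the sparse case thus share one
-- constant, the sum of theirs.
upper-mono : ∀ {P P′ n r m} → P ≤ P′ → r ≤ n → UpperBound P n r m → UpperBound P′ n r m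
upper-mono {P} {P′} {n} {r} {m} P≤P′ r≤n bound = begin
  X * r ^ (P′ * s)                       ≡⟨ cong (X *_) (split r) ⟩
  X * (r ^ (P * s) * r ^ (Δ * s))        ≡⟨ *-assoc X _ _ ⟨
  X * r ^ (P * s) * r ^ (Δ * s)          ≤⟨ *-mono-≤ bound (^-monoˡ-≤ (Δ * s) r≤n) ⟩
  n ^ (P * s) * n ^ (Δ * s)              ≡⟨ split n ⟨
  n ^ (P′ * s)                           ∎
  where
  open ≤-Reasoning
  s = r * r
  Δ = P′ ∸ P
  X = m ^ (1 * n)
  split : ∀ x → x ^ (P′ * s) ≡ x ^ (P * s) * x ^ (Δ * s)
  split x = trans (cong (λ z → x ^ (z * s)) (sym (m+[n∸m]≡n P≤P′)))
    (trans (cong (x ^_) (*-distribʳ-+ s P Δ)) (^-distribˡ-+-* x (P * s) (Δ * s)))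

-- 3r ≤ 2n and 4·2⁴ ≤ 3⁴ absorb the 4^r edges.
upper-dense : ∀ A n r m → 2 ≤ r → 2 * r ≤ n + 1 → n ≤ A * r → m ≤ 4 ^ r → UpperBound (4 * A) n r m
upper-dense A n r m 2≤r 2r≤n+1 n≤Ar m≤4^r = *-cancelʳ-≤ _ _ (16 ^ E) {{m^n≢0 16 E}} (begin
  m ^ (1 * n) * r ^ (4 * A * s) * 16 ^ E    ≡⟨ cong (λ z → m ^ (1 * n) * z * 16 ^ E) (power r) ⟩
  m ^ (1 * n) * (r ^ 4) ^ E * 16 ^ E        ≤⟨ *-monoˡ-≤ (16 ^ E) (*-monoˡ-≤ ((r ^ 4) ^ E) m^n≤) ⟩
  4 ^ E * (r ^ 4) ^ E * 16 ^ E              ≡⟨ trans (^-distribʳ-* (4 * r ^ 4) 16 E) (cong (_* 16 ^ E) (^-distribʳ-* 4 (r ^ 4) E)) ⟨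
  (4 * r ^ 4 * 16) ^ E                      ≤⟨ ^-monoˡ-≤ E base ⟩
  (n ^ 4 * 16) ^ E                          ≡⟨ ^-distribʳ-* (n ^ 4) 16 E ⟩
  (n ^ 4) ^ E * 16 ^ E                      ≡⟨ cong (_* 16 ^ E) (power n) ⟨
  n ^ (4 * A * s) * 16 ^ E                  ∎)
  where
  open ≤-Reasoning
  s = r * r
  E = A * s
  power : ∀ x → x ^ (4 * A * s) ≡ (x ^ 4) ^ E
  power x = trans (cong (x ^_) (*-assoc 4 A s)) (sym (^-*-assoc x 4 E))
  m^n≤ : m ^ (1 * n) ≤ 4 ^ E
  m^n≤ = begin
    m ^ (1 * n)        ≡⟨ cong (m ^_) (*-identityˡ n) ⟩
    m ^ n              ≤⟨ ^-monoˡ-≤ n m≤4^r ⟩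
    (4 ^ r) ^ n        ≡⟨ ^-*-assoc 4 r n ⟩
    4 ^ (r * n)        ≤⟨ ^-monoʳ-≤ 4 (*-monoʳ-≤ r n≤Ar) ⟩
    4 ^ (r * (A * r))  ≡⟨ cong (4 ^_) (a1 r A) ⟩
    4 ^ E              ∎
    where
    a1 : ∀ r A → r * (A * r) ≡ A * (r * r)
    a1 = solve-∀
  3r≤2n : 3 * r ≤ 2 * n
  3r≤2n = +-cancelʳ-≤ 2 _ _ (begin
    3 * r + 2        ≤⟨ +-monoʳ-≤ (3 * r) 2≤r ⟩
    3 * r + r        ≡⟨ a1 r ⟩
    2 * (2 * r)      ≤⟨ *-monoʳ-≤ 2 2r≤n+1 ⟩
    2 * (n + 1)      ≡⟨ *-distribˡ-+ 2 n 1 ⟩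
    2 * n + 2        ∎)
    where
    a1 : ∀ r → 3 * r + r ≡ 2 * (2 * r)
    a1 = solve-∀
  base : 4 * r ^ 4 * 16 ≤ n ^ 4 * 16
  base = begin
    4 * r ^ 4 * 16     ≡⟨ a1 (r ^ 4) ⟩
    64 * r ^ 4         ≤⟨ *-monoˡ-≤ (r ^ 4) (m≤m+n 64 17) ⟩
    81 * r ^ 4         ≡⟨ ^-distribʳ-* 3 r 4 ⟨
    (3 * r) ^ 4        ≤⟨ ^-monoˡ-≤ 4 3r≤2n ⟩
    (2 * n) ^ 4        ≡⟨ ^-distribʳ-* 2 n 4 ⟩
    16 * n ^ 4         ≡⟨ *-comm 16 (n ^ 4) ⟩
    n ^ 4 * 16         ∎
    where
    a1 : ∀ x → 4 * x * 16 ≡ 64 * x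
    a1 = solve-∀

-- From n ≤ Aqr and tq ≤ r follows tn ≤ Ar², so m^n ≤ q^(11Ar²), and q is at most n/r.
upper-sparse : ∀ A n r q t m → 0 < q → q * r ≤ n → n ≤ A * (q * r) → t * q ≤ r → m ≤ q ^ (11 * t) →
               UpperBound (11 * A) n r m
upper-sparse A n r q t m 0<q qr≤n n≤Aqr tq≤r m≤ = begin
  m ^ (1 * n) * r ^ E      ≤⟨ *-monoˡ-≤ (r ^ E) m^n≤ ⟩
  q ^ E * r ^ E            ≡⟨ ^-distribʳ-* q r E ⟨
  (q * r) ^ E              ≤⟨ ^-monoˡ-≤ E qr≤n ⟩
  n ^ E                    ∎
  where
  open ≤-Reasoning
  E = 11 * A * (r * r)
  m^n≤ : m ^ (1 * n) ≤ q ^ E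
  m^n≤ = begin
    m ^ (1 * n)            ≡⟨ cong (m ^_) (*-identityˡ n) ⟩
    m ^ n                  ≤⟨ ^-monoˡ-≤ n m≤ ⟩
    (q ^ (11 * t)) ^ n     ≡⟨ ^-*-assoc q (11 * t) n ⟩
    q ^ (11 * t * n)       ≤⟨ ^-monoʳ-≤ q {{>-nonZero 0<q}} exponent ⟩
    q ^ E                  ∎
    where
    a1 : ∀ t A q r → 11 * t * (A * (q * r)) ≡ 11 * A * (t * q * r)
    a1 = solve-∀
    exponent : 11 * t * n ≤ E
    exponent = begin
      11 * t * n               ≤⟨ *-monoʳ-≤ (11 * t) n≤Aqr ⟩
      11 * t * (A * (q * r))   ≡⟨ a1 t A q r ⟩
      11 * A * (t * q * r)     ≤⟨ *-monoʳ-≤ (11 * A) (*-monoˡ-≤ r tq≤r) ⟩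
      E                        ∎

m<[1+m/n]*n : ∀ m n .{{_ : NonZero n}} → m < suc (m / n) * n
m<[1+m/n]*n m n = begin-strict
  m                     ≡⟨ m≡m%n+[m/n]*n m n ⟩
  m % n + m / n * n     <⟨ +-monoˡ-< (m / n * n) (m%n<n m n) ⟩
  suc (m / n) * n       ∎
  where open ≤-Reasoning

module _ (a n r : ℕ) (2≤r : 2 ≤ r) (2r≤n+1 : 2 * r ≤ n + 1) (n≤ar² : n ≤ a * (r * r)) where
  open ≤-Reasoning

  private
    instance
      r≢0 : NonZero r
      r≢0 = >-nonZero (≤-trans (s≤s z≤n) 2≤r)
      6r≢0 : NonZero (6 * r)
      6r≢0 = m*n≢0 6 r

  -- Here no prime fits. Either n < 12r, or r < 16 and n ≤ ar² ≤ 16ar.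
  dense : n / (6 * r) ⊓ (r / 8) < 2 → n ≤ (12 + 16 * a) * r
  dense x<2 with m⊓n<o⇒m<o∨n<o (n / (6 * r)) (r / 8) x<2
    where
    m⊓n<o⇒m<o∨n<o : ∀ m n {o} → m ⊓ n < o → m < o ⊎ n < o
    m⊓n<o⇒m<o∨n<o m n m⊓n<o with ⊓-sel m n
    ... | inj₁ eq = inj₁ (subst (_< _) eq m⊓n<o)
    ... | inj₂ eq = inj₂ (subst (_< _) eq m⊓n<o)
  ... | inj₁ x₁<2 = begin
    n                              ≤⟨ <⇒≤ (m<[1+m/n]*n n (6 * r)) ⟩
    suc (n / (6 * r)) * (6 * r)    ≤⟨ *-monoˡ-≤ (6 * r) x₁<2 ⟩
    2 * (6 * r)                    ≡⟨ *-assoc 2 6 r ⟨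
    12 * r                         ≤⟨ *-monoˡ-≤ r (m≤m+n 12 (16 * a)) ⟩
    (12 + 16 * a) * r              ∎
  ... | inj₂ x₂<2 = begin
    n                              ≤⟨ n≤ar² ⟩
    a * (r * r)                    ≤⟨ *-monoʳ-≤ a (*-monoˡ-≤ r (≤-trans (<⇒≤ (m<[1+m/n]*n r 8)) (*-monoˡ-≤ 8 x₂<2))) ⟩
    a * (16 * r)                   ≡⟨ a1 a r ⟩
    16 * a * r                     ≤⟨ *-monoˡ-≤ r (m≤n+m (16 * a) 12) ⟩
    (12 + 16 * a) * r              ∎
    where
    a1 : ∀ a r → a * (16 * r) ≡ 16 * a * r
    a1 = solve-∀

  -- Whichever term attains the minimum determines the order of q: n/r, or r, and in the latter case
  -- n ≤ ar² still gives n = O(qr).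
  sparse : ∀ c q → 2 ≤ n / (6 * r) ⊓ (r / 8) → n / (6 * r) ⊓ (r / 8) ≤ c * q →
           n ≤ (12 * c + 16 * c * a) * (q * r)
  sparse c q 2≤x x≤cq with ⊓-sel (n / (6 * r)) (r / 8)
  ... | inj₁ eq = begin
    n                              ≤⟨ <⇒≤ (m<[1+m/n]*n n (6 * r)) ⟩
    suc (n / (6 * r)) * (6 * r)    ≤⟨ *-monoˡ-≤ (6 * r) (1+x≤2cq (n / (6 * r)) eq) ⟩
    2 * (c * q) * (6 * r)          ≡⟨ a1 c q r ⟩
    12 * c * (q * r)               ≤⟨ *-monoˡ-≤ (q * r) (m≤m+n (12 * c) _) ⟩
    (12 * c + 16 * c * a) * (q * r) ∎
    where
    1+x≤2cq : ∀ y → n / (6 * r) ⊓ (r / 8) ≡ y → suc y ≤ 2 * (c * q)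
    1+x≤2cq y refl = ≤-trans (+-monoˡ-≤ _ (≤-trans (s≤s z≤n) 2≤x)) (≤-trans (+-mono-≤ x≤cq x≤cq) (≤-reflexive (cong (c * q +_) (sym (+-identityʳ _)))))
    a1 : ∀ c q r → 2 * (c * q) * (6 * r) ≡ 12 * c * (q * r)
    a1 = solve-∀
  ... | inj₂ eq = begin
    n                              ≤⟨ n≤ar² ⟩
    a * (r * r)                    ≤⟨ *-monoʳ-≤ a (*-monoˡ-≤ r (≤-trans (<⇒≤ (m<[1+m/n]*n r 8)) (*-monoˡ-≤ 8 (1+x≤2cq (r / 8) eq)))) ⟩
    a * (2 * (c * q) * 8 * r)      ≡⟨ a1 a c q r ⟩
    16 * c * a * (q * r)           ≤⟨ *-monoˡ-≤ (q * r) (m≤n+m (16 * c * a) (12 * c)) ⟩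
    (12 * c + 16 * c * a) * (q * r) ∎
    where
    1+x≤2cq : ∀ y → n / (6 * r) ⊓ (r / 8) ≡ y → suc y ≤ 2 * (c * q)
    1+x≤2cq y refl = ≤-trans (+-monoˡ-≤ _ (≤-trans (s≤s z≤n) 2≤x)) (≤-trans (+-mono-≤ x≤cq x≤cq) (≤-reflexive (cong (c * q +_) (sym (+-identityʳ _)))))
    a1 : ∀ a c q r → a * (2 * (c * q) * 8 * r) ≡ 16 * c * a * (q * r)
    a1 = solve-∀

  r≤n : r ≤ n
  r≤n = +-cancelʳ-≤ 1 r n (begin
    r + 1    ≤⟨ +-monoʳ-≤ r (≤-trans (s≤s z≤n) 2≤r) ⟩
    r + r    ≡⟨ cong (r +_) (+-identityʳ r) ⟨
    2 * r    ≤⟨ 2r≤n+1 ⟩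
    n + 1    ∎)

  -- The bound is stated for all smaller `m` too, since f(n, r) is only known to be at most the
  -- number of edges of `H`.
  few-edges : ∀ c → (∀ x → 2 ≤ x → ∃ λ p → Prime p × p ≤ x × x ≤ c * p) →
              Σ (Hypergraph n) λ H → Admissible n r H ×
              (∀ m → m ≤ numEdges H → UpperBound (4 * (12 + 16 * a) + 11 * (12 * c + 16 * c * a)) n r m)
  few-edges c primes = [ via-complete , via-plane ]′ (<-≤-connex x 2)
    where
    -- The largest `q` that meets both size requirements of `plane-hypergraph`.
    x = n / (6 * r) ⊓ (r / 8)
    A = 12 + 16 * a
    B = 12 * c + 16 * c * a
    Goal = Σ (Hypergraph n) λ H → Admissible n r H × (∀ m → m ≤ numEdges H → UpperBound (4 * A + 11 * B) n r m)
    via-complete : x < 2 → Goal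
    via-complete x<2 =
      let H , adm , few = complete-hypergraph n r 2≤r 2r≤n+1
      in H , adm , λ m m≤ → upper-mono {P = 4 * A} {m = m} (m≤m+n (4 * A) (11 * B)) r≤n
           (upper-dense A n r m 2≤r 2r≤n+1 (dense x<2) (≤-trans m≤ few))
    8q≤ : ∀ q → q ≤ x → 8 * q ≤ r
    8q≤ q q≤x = begin
      8 * q          ≡⟨ *-comm 8 q ⟩
      q * 8          ≤⟨ *-monoˡ-≤ 8 (≤-trans q≤x (m⊓n≤n (n / (6 * r)) (r / 8))) ⟩
      r / 8 * 8      ≤⟨ m/n*n≤m r 8 ⟩
      r              ∎
    6qr≤ : ∀ q → q ≤ x → 6 * q * r ≤ n
    6qr≤ q q≤x = begin
      6 * q * r                ≡⟨ trans (cong (_* r) (*-comm 6 q)) (*-assoc q 6 r) ⟩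
      q * (6 * r)              ≤⟨ *-monoˡ-≤ (6 * r) (≤-trans q≤x (m⊓n≤m (n / (6 * r)) (r / 8))) ⟩
      n / (6 * r) * (6 * r)    ≤⟨ m/n*n≤m n (6 * r) ⟩
      n                        ∎
    via-plane : 2 ≤ x → Goal
    via-plane 2≤x =
      let q , q-prime , q≤x , x≤cq = primes x 2≤x
          t , tq≤r , H , adm , few = plane-hypergraph n r q q-prime (8q≤ q q≤x) (6qr≤ q q≤x)
      in H , adm , λ m m≤ → upper-mono {P = 11 * B} {m = m} (m≤n+m (11 * B) (4 * A)) r≤n
           (upper-sparse B n r q t m (0<prime q-prime) (≤-trans (*-monoˡ-≤ r (m≤n*m q 6)) (6qr≤ q q≤x))
             (sparse c q 2≤x x≤cq) tq≤r (≤-trans m≤ few))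

-- Here K = a/b, c = p/q and C = P/Q, and both inequalities are raised to a power to clear the
-- fractions. Rational K lose nothing, because the claim for a larger K implies that for a smaller
-- one.
theorem1p1 : ∀ (a b : ℕ) → 0 < a → 0 < b →
    Σ ℕ λ p → Σ ℕ λ q → Σ ℕ λ P → Σ ℕ λ Q →
    0 < p × 0 < q × 0 < P × 0 < Q ×
    (∀ (r n : ℕ) → 2 ≤ r → 2 * r ≤ n + 1 → b * n ≤ a * (r * r) →
    Σ ℕ λ m → IsF n r m ×
    (2 ^ (p * (r * r)) ≤ m ^ (q * n)) ×
    (m ^ (Q * n) * r ^ (P * (r * r)) ≤ n ^ (P * (r * r))))
theorem1p1 a b 0<a 0<b = fromPrimes ∃c∀x∃prime≤x≤c*prime
  where
  Claim : ℕ → Set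
  Claim P = ∀ (r n : ℕ) → 2 ≤ r → 2 * r ≤ n + 1 → b * n ≤ a * (r * r) →
    Σ ℕ λ m → IsF n r m × (2 ^ (1 * (r * r)) ≤ m ^ (4 * n)) × UpperBound P n r m
  main : ∀ c → (∀ x → 2 ≤ x → ∃ λ p → Prime p × p ≤ x × x ≤ c * p) → Claim (4 * (12 + 16 * a) + 11 * (12 * c + 16 * c * a))
  main c primes (suc j) n 2≤r@(s≤s 0<j) 2r≤n+1 bn≤ar² =
    let H , adm , upper = few-edges a n (suc j) 2≤r 2r≤n+1 (≤-trans (m≤n*m n b {{>-nonZero 0<b}}) bn≤ar²) c primes
        m , m≤ , isF@((H′ , adm′ , m≡) , _) = minimum H adm
    in m , isF
     , lower-exponent n j m r<n 0<j (subst (λ m → n ^ j ≤ m * (n ∸ suc j) ^ j) m≡ (greedy-bound H′ (≤-<-trans z≤n r<n) adm′))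
     , upper m m≤
    where
    r<n : suc j < n
    r<n = +-cancelʳ-≤ 1 (suc (suc j)) n (begin
      suc (suc j) + 1   ≡⟨ +-comm (suc (suc j)) 1 ⟩
      2 + (1 + j)       ≤⟨ +-monoʳ-≤ 2 (+-monoˡ-≤ j 0<j) ⟩
      2 + (j + j)       ≡⟨ double j ⟩
      2 * suc j         ≤⟨ 2r≤n+1 ⟩
      n + 1             ∎)
      where
      open ≤-Reasoning
      double : ∀ j → 2 + (j + j) ≡ 2 * suc j
      double = solve-∀
  fromPrimes : (∃ λ c → ∀ x → 2 ≤ x → ∃ λ p → Prime p × p ≤ x × x ≤ c * p) → _
  fromPrimes (c , primes) = 1 , 4 , 4 * (12 + 16 * a) + 11 * (12 * c + 16 * c * a) , 1 , z<s , z<s , z<s , z<s , main c primes
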